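{- Let $k=2^{\ell}$ with $\ell\ge2$ an integer and $q=4k$. Let $f\in\mathbb F_q[X,Y]$ be a local permutation polynomial whose permutation polynomial tuple consists of the $q$ elements of the group $G_3=\{b^ja^i:0\le j\le 2k-1,\ 0\le i\le 1\}$ (in some order), where $a$ and $b$ are as defined below. Then $f$ has a companion.
   Context: The elements of $\mathbb F_q$ are enumerated as $\mathbb F_q=\{c_0,\dots,c_{q-1}\}$; $\mathfrak S_q$ is the symmetric group of permutations of $\mathbb F_q$, composed right to left, written in cycle notation. $a=(c_0,c_1)(c_2,c_3)\cdots(c_{q-2},c_{q-1})$ and $b=D_1D_2$, where $D_1$ is the $2k$-cycle whose entries in order are: for $i=0,1,\dots,\frac{k-2}{2}$ the pair $c_{2i},c_{2i+2k+1}$; then $c_{k+1},c_{3k}$; then for $j=0,1,\dots,\frac{k-4}{2}$ the pair $c_{k+2j+2},c_{3k+2j+2}$; and $D_2$ is the $2k$-cycle whose entries in order are: for $j=0,1,\dots,\frac{k-4}{2}$ the pair $c_{3k-2-2j},c_{2k-1-2j}$; then $c_{2k},c_k$; then for $i=0,1,\dots,\frac{k-2}{2}$ the pair $c_{4k-1-2i},c_{k-1-2i}$. ($G_3$ is a subgroup of $\mathfrak S_q$ of order $q$ whose non-identity elements have no fixed points.) Every function $\mathbb F_q^2\to\mathbb F_q$ is identified with the unique polynomial in $\mathbb F_q[X,Y]$ of degree $<q$ in each variable representing it. $f$ is a local permutation polynomial (LPP) if $x\mapsto f(x,y_0)$ and $y\mapsto f(x_0,y)$ are permutations of $\mathbb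 F_q$ for all $x_0,y_0$. A permutation polynomial tuple is $(\beta_0,\dots,\beta_{q-1})\in\mathfrak S_q^q$ such that $\beta_i^{ -1}\beta_j$ has no fixed point whenever $i\ne j$; LPPs $f$ correspond bijectively to such tuples via $f(x,\beta_i(x))=c_i$ for all $x$ and all $i$. Two LPPs $f,g$ are orthogonal (companions) if for every $(u,v)\in\mathbb F_q^2$ the system $f(X,Y)=u$, $g(X,Y)=v$ has exactly one solution in $\mathbb F_q^2$; a companion of $f$ is an LPP orthogonal to $f$. -}

module Defs where

open import Algebra.Bundles using (CommutativeRing)
import Algebra.Properties.Semiring.Exp as Exp
import Algebra.Properties.Semiring.Sum as Sum
open import Data.Bool.Base using (if_then_else_)
open import Data.Fin.Base using (Fin; toℕ)
open import Data.Fin.Properties using (nonZeroIndex; inj⇒≟; ≡-setoid)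
open import Data.List.Base using (List; []; _∷_; _++_; concatMap; foldr; map; upTo)
open import Data.Nat.Base using (ℕ; suc; _+_; _∸_; _≤_) renaming (_*_ to _·_)
open import Data.Nat.DivMod using (_/_; _mod_)
open import Data.Product.Base using (∃; ∃₂; _×_; _,_)
open import Data.Product using (∃!)
open import Data.Product.Relation.Binary.Pointwise.NonDependent using (Pointwise)
open import Function.Base using (id; _∘_)
open import Function.Bundles using (Inverse)
import Function.Construct.Symmetry as Symmetry
open import Function.Definitions using (Bijective)
import Function.Endo.Propositional as Endo
open import Function.Properties.Inverse using (Inverse⇒Injection)
open import Level using (Level; _⊔_)
open import Relation.Binary.Definitions using (Decidable)
open import Relation.Binary.PropositionalEquality.Core using (_≡_)
open import Relation.Nullary.Decidable.Core using (⌊_⌋)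
open import Relation.Nullary.Negation.Core using (¬_)

record FiniteField (c r : Level) (q : ℕ) : Set (Level.suc (c ⊔ r)) where
  field
    commutativeRing : CommutativeRing c r
  open CommutativeRing commutativeRing public
  field
    0≉1         : ¬ (0# ≈ 1#)
    inverse     : ∀ x → ¬ (x ≈ 0#) → ∃ λ y → x * y ≈ 1#
    enumeration : Inverse (≡-setoid q) setoid

module _ {c r : Level} {q : ℕ} (F : FiniteField c r q) where
  open FiniteField F using (Carrier; _≈_; _*_; 0#; setoid; semiring; enumeration)
  open Exp semiring using (_^_)
  open Sum semiring using (sum)

  decEq : Decidable _≈_
  decEq = inj⇒≟ (Inverse⇒Injection (Symmetry.inverse enumeration))

  element : Fin q → Carrier
  element = Inverse.to enumeration

  -- The element cₙ for n < q.  Reducing n modulo q only serves to make this a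
  -- total function on ℕ: every index occurring below is smaller than q as soon
  -- as q = 4k with k ≥ 4 even.
  elementℕ : ℕ → Carrier
  elementℕ n = element (n mod q)
    where instance _ = nonZeroIndex (Inverse.from enumeration 0#)

  -- Polynomials in X and Y of degree < q in each variable: f i j is the
  -- coefficient of XⁱYʲ.
  Polynomial : Set c
  Polynomial = Fin q → Fin q → Carrier

  eval : Polynomial → Carrier → Carrier → Carrier
  eval f x y = sum λ i → sum λ j → f i j * (x ^ toℕ i * y ^ toℕ j)

  IsLPP : Polynomial → Set (c ⊔ r)
  IsLPP f = (∀ y₀ → Bijective _≈_ _≈_ λ x → eval f x y₀)
          × (∀ x₀ → Bijective _≈_ _≈_ λ y → eval f x₀ y)

  Orthogonal : Polynomial → Polynomial → Set (c ⊔ r)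
  Orthogonal f g = ∀ u v → ∃! (Pointwise _≈_ _≈_) λ ((x , y) : Carrier × Carrier) →
    eval f x y ≈ u × eval g x y ≈ v

  IsCompanion : Polynomial → Polynomial → Set (c ⊔ r)
  IsCompanion f g = IsLPP g × Orthogonal f g

  Permutation : Set (c ⊔ r)
  Permutation = Inverse setoid setoid

  open Inverse using (to; from)

  IsPermutationPolynomialTuple : (Fin q → Permutation) → Set (c ⊔ r)
  IsPermutationPolynomialTuple β =
    ∀ i j → ¬ (i ≡ j) → ∀ x → ¬ (from (β i) (to (β j) x) ≈ x)

  IsTupleOf : (Fin q → Permutation) → Polynomial → Set (c ⊔ r)
  IsTupleOf β f = IsPermutationPolynomialTuple β
                × (∀ i x → eval f x (to (β i) x) ≈ element i)

  -- Cycle notation: each entry is sent to the next one, the last entry to the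
  -- first, and all other elements are fixed.  The list is meant to have no
  -- repeated entries.
  cycle : List Carrier → Carrier → Carrier
  cycle []       x = x
  cycle (h ∷ es) x = go h es
    module Cycle where
    go : Carrier → List Carrier → Carrier
    go e []        = if ⌊ decEq x e ⌋ then h else x
    go e (e′ ∷ es) = if ⌊ decEq x e ⌋ then e′ else go e′ es

  -- a and b are given as the functions underlying these elements of 𝔖_q.
  a : Carrier → Carrier
  a = foldr _∘_ id
    (map (λ i → cycle (elementℕ (2 · i) ∷ elementℕ (2 · i + 1) ∷ [])) (upTo (q / 2)))

  module _ (k : ℕ) where
    -- Index lists of the cycles; upTo (suc n) is 0, 1, …, n.
    D₁-indices : List ℕ
    D₁-indices =
         concatMap (λ i → 2 · i ∷ 2 · i + 2 · k + 1 ∷ []) (upTo (suc ((k ∸ 2) / 2)))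
      ++ (k + 1 ∷ 3 · k ∷ [])
      ++ concatMap (λ j → k + 2 · j + 2 ∷ 3 · k + 2 · j + 2 ∷ []) (upTo (suc ((k ∸ 4) / 2)))

    D₂-indices : List ℕ
    D₂-indices =
         concatMap (λ j → 3 · k ∸ 2 ∸ 2 · j ∷ 2 · k ∸ 1 ∸ 2 · j ∷ []) (upTo (suc ((k ∸ 4) / 2)))
      ++ (2 · k ∷ k ∷ [])
      ++ concatMap (λ i → 4 · k ∸ 1 ∸ 2 · i ∷ k ∸ 1 ∸ 2 · i ∷ []) (upTo (suc ((k ∸ 2) / 2)))

    b : Carrier → Carrier
    b = cycle (map elementℕ D₁-indices) ∘ cycle (map elementℕ D₂-indices)

    open Endo Carrier using () renaming (_^_ to _^∘_)

    -- Exponent bounds 0 ≤ j ≤ 2k − 1 and 0 ≤ i ≤ 1.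
    G₃ : (Carrier → Carrier) → Set (c ⊔ r)
    G₃ g = ∃₂ λ j i → j ≤ 2 · k ∸ 1 × i ≤ 1 × (∀ x → g x ≈ ((b ^∘ j) ∘ (a ^∘ i)) x)

    ConsistsOfG₃ : (Fin q → Permutation) → Set (c ⊔ r)
    ConsistsOfG₃ β = (∀ m → G₃ (to (β m)))
                   × (∀ g → G₃ g → ∃ λ m → ∀ x → to (β m) x ≈ g x)

{-# OPTIONS --safe #-}

-- If γ permutes the group G₃ and so does β ↦ δ(β) = βγ(β) (a complete mapping), then the cells
-- (γ(β)(u), δ(β)(u)), β ∈ G₃, form a transversal of f for each u, and the function with value u on
-- the u-th transversal is a companion of f.  The group is semidihedral: a² = 1, b²ᵏ = 1 and
-- bab = bᵏa.  A complete mapping is, for 0 ≤ j < k,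
--   bʲ ↦ bʲ,   bᵏ⁺ʲ ↦ bᵏ⁺ʲ⁺¹a,   abᵏ⁺ʲ ↦ bᵏ⁺ʲ,   abʲ ↦ bʲ⁺¹a,
-- with products b²ʲ, b²ʲ⁺¹a, ab²ʲ, ab²ʲ⁺¹a.  That words in a and b act freely is inferred by
-- counting from the hypothesis that G₃ is the tuple of f; only the relations are read off the cycles.

module Submission where

open import Defs
import Algebra.Properties.Group as GroupProperties
import Algebra.Properties.Semiring.Exp as Exp
import Algebra.Properties.Semiring.Sum as Sum
open import Data.Bool.Base using (Bool; true; false)
open import Data.Empty using (⊥-elim)
open import Data.Fin.Base using (Fin; zero; suc; toℕ; fromℕ<; combine; remQuot; punchOut)
open import Data.Fin.Patterns using (0F; 1F; 2F; 3F)
open import Data.Fin.Properties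
  using (any?; punchOut-injective; injective⇒≤; suc-injective; 0≢1+n; nonZeroIndex; toℕ<n;
         toℕ-injective; toℕ-fromℕ<; fromℕ<-injective; toℕ-combine; combine-injective; combine-remQuot)
  renaming (_≟_ to _≟ᶠ_)
open import Data.List.Base using (List; []; _∷_; _++_; [_]; map; concatMap; foldr; upTo; applyUpTo)
open import Data.List.Membership.Propositional using (_∈_; lose)
open import Data.List.Membership.Propositional.Properties
  using (∈-upTo⁺; ∈-upTo⁻; ∈-++⁺ˡ; ∈-++⁺ʳ; ∈-concatMap⁺)
open import Data.List.Properties using (map-++; map-∘; ++-assoc)
open import Data.List.Relation.Unary.All as All using (All; []; _∷_)
import Data.List.Relation.Unary.All.Properties as All
open import Data.List.Relation.Unary.AllPairs using (_∷_)
open import Data.List.Relation.Unary.Any using (here; there)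
open import Data.List.Relation.Unary.Linked using (Linked; [-]; _∷_)
open import Data.List.Relation.Unary.Unique.Propositional using (Unique)
open import Data.List.Relation.Unary.Unique.Propositional.Properties using (upTo⁺)
open import Data.Nat.Base as ℕ using (ℕ; zero; suc; _≤_; _<_; z≤n; s≤s)
open import Data.Nat.Divisibility using (divides)
open import Data.Nat.DivMod
  using (_%_; _/_; _mod_; m≡m%n+[m/n]*n; m%n<n; m<n⇒m%n≡m; m∣n⇒o%n%m≡o%m; [m+kn]%n≡m%n;
         %-congˡ; m*n%n≡0; m*n/n≡m; m<n*o⇒m/o<n)
import Data.Nat.Properties as ℕ
open import Data.Nat.Tactic.RingSolver using (solve-∀)
open import Data.Product.Base using (∃; ∃₂; _×_; _,_; proj₁; proj₂)
open import Function.Base using (_∘_; id)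
open import Function.Bundles using (Inverse)
open import Function.Definitions using (Injective; Bijective)
import Function.Endo.Propositional as Endo
open import Level using (Level; _⊔_)
import Relation.Binary.Reasoning.Setoid as SetoidReasoning
open import Relation.Binary.PropositionalEquality as ≡ using (_≡_; _≢_)
open import Relation.Nullary.Decidable.Core using (yes; no)
open import Relation.Nullary.Negation.Core using (¬_; contradiction)

-- On the cyclic group ⟨b⟩ squaring hits every even power twice and no odd power, so the identity
-- map cannot serve as γ; the letter a repairs this. Fixing bʲ for j < k uses each even power once.
-- On the other three pieces exponents still double modulo 2k, but two of these pieces shift the
-- exponent by one, so that their products are odd. It remains to tell even products from odd ones
-- although some carry a on both sides. Moving a past bⁿ turns n into -n for even n and into k - n
-- for odd n, and k is even, so the parity of the exponent survives the move. The relations are read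
-- off in coordinates: an index below 4k is kQ + 2u + p with p < 2; a flips p, and b moves (Q, u, p)
-- by a short table of cases.

4k≡2k*2 : ∀ k → 4 ℕ.* k ≡ 2 ℕ.* k ℕ.* 2
4k≡2k*2 = solve-∀

-- Pigeonhole: a missed value can be punched out of the codomain, which leaves an injection into a
-- set with one element fewer. The sizes are related by an equation because 4k and 2k · 2, to which
-- this is applied later, are not the same by computation.
injective⇒surjective : ∀ {m n} → m ≡ n → (f : Fin m → Fin n) → Injective _≡_ _≡_ f →
  ∀ y → ∃ λ x → f x ≡ y
injective⇒surjective {suc n} ≡.refl f inj y with any? (λ x → f x ≟ᶠ y)
... | yes found = found
... | no  missed = ⊥-elim (ℕ.1+n≰n (injective⇒≤ squeezed-injective))
  where
  avoids : ∀ x → y ≢ f x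
  avoids x y≡fx = missed (x , ≡.sym y≡fx)

  squeezed-injective : Injective _≡_ _≡_ (λ x → punchOut (avoids x))
  squeezed-injective {x} {x′} eq = inj (punchOut-injective (avoids x) (avoids x′) eq)

-- Interpolation and companions over a finite field

module FieldTheory {c r : Level} {q : ℕ} (F : FiniteField c r q) where
  open FiniteField F hiding (zero)
  open Exp semiring using (_^_; ^-congˡ)
  open Sum semiring using (sum; sum-cong-≋; ∑-distrib-+; *-distribˡ-sum; *-distribʳ-sum)
  open GroupProperties +-group using () renaming (x∙y⁻¹≈ε⇒x≈y to x-y≈0⇒x≈y)
  open SetoidReasoning setoid
  open Endo Carrier using () renaming (_^_ to _^∘_)

  element-injective : ∀ {i j} → element F i ≈ element F j → i ≡ j
  element-injective {i} {j} eq =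
    ≡.trans (≡.sym (Inverse.strictlyInverseʳ enumeration i))
            (≡.trans (Inverse.from-cong enumeration eq) (Inverse.strictlyInverseʳ enumeration j))

  index : Carrier → Fin q
  index = Inverse.from enumeration

  element-index : ∀ x → element F (index x) ≈ x
  element-index = Inverse.strictlyInverseˡ enumeration

  family-surjective : (φ : Fin q → Carrier) → (∀ {i j} → φ i ≈ φ j → i ≡ j) →
    ∀ y → ∃ λ i → φ i ≈ y
  family-surjective φ inj y = let i , eq = injective⇒surjective ≡.refl (index ∘ φ) index-φ-injective (index y) in
    i , trans (sym (element-index (φ i))) (trans (reflexive (≡.cong (element F) eq)) (element-index y))
    where
    index-φ-injective : Injective _≡_ _≡_ (index ∘ φ)
    index-φ-injective {i} {j} eq = inj (begin
      φ i                      ≈⟨ element-index (φ i) ⟨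
      element F (index (φ i))  ≡⟨ ≡.cong (element F) eq ⟩
      element F (index (φ j))  ≈⟨ element-index (φ j) ⟩
      φ j                      ∎)

  map-surjective : (φ : Carrier → Carrier) → (∀ {x y} → φ x ≈ φ y → x ≈ y) →
    ∀ y → ∃ λ x → φ x ≈ y
  map-surjective φ inj y
    with i , eq ← family-surjective (φ ∘ element F) (element-injective ∘ inj) y = element F i , eq

  eval₁ : ∀ {n} → (Fin n → Carrier) → Carrier → Carrier
  eval₁ coeffs x = sum λ i → coeffs i * x ^ toℕ i

  Representable : ℕ → (Carrier → Carrier) → Set (c ⊔ r)
  Representable n φ = ∃ λ (coeffs : Fin n → Carrier) → ∀ x → eval₁ coeffs x ≈ φ x

  horner : ∀ {n φ} y → Representable n φ → Representable (suc n) (λ x → y + x * φ x)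
  horner {n} {φ} y (coeffs , correct) = coeffs⁺ , λ x → +-cong (*-identityʳ y) (begin
    sum (λ i → coeffs i * (x * x ^ toℕ i))   ≈⟨ sum-cong-≋ (λ i → swap (coeffs i) x (x ^ toℕ i)) ⟩
    sum (λ i → x * (coeffs i * x ^ toℕ i))   ≈⟨ *-distribˡ-sum x (λ i → coeffs i * x ^ toℕ i) ⟨
    x * eval₁ coeffs x                       ≈⟨ *-congˡ (correct x) ⟩
    x * φ x                                  ∎)
    where
    coeffs⁺ : Fin (suc n) → Carrier
    coeffs⁺ zero    = y
    coeffs⁺ (suc i) = coeffs i

    swap : ∀ x y z → x * (y * z) ≈ y * (x * z)
    swap x y z = trans (sym (*-assoc x y z)) (trans (*-congʳ (*-comm x y)) (*-assoc y x z))

  representable-zero : ∀ n → Representable n (λ _ → 0#)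
  representable-zero zero    = (λ ()) , λ _ → refl
  representable-zero (suc n) with coeffs , correct ← horner 0# (representable-zero n) =
    coeffs , λ x → trans (correct x) (trans (+-identityˡ _) (zeroʳ x))

  -- The sum unfolds at its constant term, while the new zero coefficient belongs at the top degree.
  -- So the constant term is split off in Horner form and the recursion descends to the top.
  representable-weaken : ∀ {n φ} → Representable n φ → Representable (suc n) φ
  representable-weaken {zero} {φ} (coeffs , correct) with coeffs⁺ , correct⁺ ← representable-zero 1 =
    coeffs⁺ , λ x → trans (correct⁺ x) (correct x)
  representable-weaken {suc n} {φ} (coeffs , correct) =
    proj₁ lifted , λ x → trans (proj₂ lifted x) (trans (sym (proj₂ original x)) (correct x))
    where
    ψ : Carrier → Carrier
    ψ = eval₁ (coeffs ∘ suc)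

    ψ-representable : Representable n ψ
    ψ-representable = coeffs ∘ suc , λ x → refl

    original : Representable (suc n) (λ x → coeffs zero + x * ψ x)
    original = horner (coeffs zero) ψ-representable

    lifted : Representable (suc (suc n)) (λ x → coeffs zero + x * ψ x)
    lifted = horner (coeffs zero) (representable-weaken ψ-representable)

  representable-+ : ∀ {n φ ψ} → Representable n φ → Representable n ψ → Representable n (λ x → φ x + ψ x)
  representable-+ {n} (cφ , hφ) (cψ , hψ) = (λ i → cφ i + cψ i) , λ x → begin
    sum (λ i → (cφ i + cψ i) * x ^ toℕ i)
      ≈⟨ sum-cong-≋ {n} (λ i → distribʳ (x ^ toℕ i) (cφ i) (cψ i)) ⟩
    sum (λ i → cφ i * x ^ toℕ i + cψ i * x ^ toℕ i)
      ≈⟨ ∑-distrib-+ (λ i → cφ i * x ^ toℕ i) (λ i → cψ i * x ^ toℕ i) ⟩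
    eval₁ cφ x + eval₁ cψ x
      ≈⟨ +-cong (hφ x) (hψ x) ⟩
    _ ∎

  representable-* : ∀ {n φ} y → Representable n φ → Representable n (λ x → y * φ x)
  representable-* {n} y (cφ , hφ) = (λ i → y * cφ i) , λ x → begin
    sum (λ i → y * cφ i * x ^ toℕ i)    ≈⟨ sum-cong-≋ {n} (λ i → *-assoc y (cφ i) (x ^ toℕ i)) ⟩
    sum (λ i → y * (cφ i * x ^ toℕ i))  ≈⟨ *-distribˡ-sum y (λ i → cφ i * x ^ toℕ i) ⟨
    y * eval₁ cφ x                      ≈⟨ *-congˡ (hφ x) ⟩
    _ ∎

  -- Newton interpolation: h is interpolated by h(x₀) + (x − x₀) φ(x), where φ interpolates
  -- the divided differences (h(x) − h(x₀)) / (x − x₀) at the remaining nodes.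
  interpolation : ∀ n (node : Fin n → Carrier) → (∀ {i j} → node i ≈ node j → i ≡ j) →
    (h : Fin n → Carrier) →
    ∃ λ (coeffs : Fin n → Carrier) → ∀ i → eval₁ coeffs (node i) ≈ h i
  interpolation zero    node inj h = (λ ()) , λ ()
  interpolation (suc n) node inj h = proj₁ result , interpolates
    where
    x₀ : Carrier
    x₀ = node zero

    gap≉0 : ∀ i → ¬ (node (suc i) - x₀ ≈ 0#)
    gap≉0 i gap≈0 = 0≢1+n (≡.sym (inj (x-y≈0⇒x≈y _ _ gap≈0)))

    slope : Fin n → Carrier
    slope i = proj₁ (inverse _ (gap≉0 i)) * (h (suc i) - h zero)

    rest : ∃ λ (coeffs : Fin n → Carrier) → ∀ i → eval₁ coeffs (node (suc i)) ≈ slope i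
    rest = interpolation n (node ∘ suc) (suc-injective ∘ inj) slope

    φ : Carrier → Carrier
    φ = eval₁ (proj₁ rest)

    φ-representable : Representable n φ
    φ-representable = proj₁ rest , λ _ → refl

    result : Representable (suc n) (λ x → (h zero + x * φ x) + - x₀ * φ x)
    result = representable-+ (horner (h zero) φ-representable)
                             (representable-weaken (representable-* (- x₀) φ-representable))

    newton : ∀ x → eval₁ (proj₁ result) x ≈ h zero + (x - x₀) * φ x
    newton x = begin
      eval₁ (proj₁ result) x                ≈⟨ proj₂ result x ⟩
      (h zero + x * φ x) + - x₀ * φ x       ≈⟨ +-assoc _ _ _ ⟩
      h zero + (x * φ x + - x₀ * φ x)       ≈⟨ +-congˡ (distribʳ (φ x) x (- x₀)) ⟨
      h zero + (x - x₀) * φ x               ∎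

    interpolates : ∀ i → eval₁ (proj₁ result) (node i) ≈ h i
    interpolates zero = begin
      eval₁ (proj₁ result) x₀      ≈⟨ newton x₀ ⟩
      h zero + (x₀ - x₀) * φ x₀    ≈⟨ +-congˡ (*-congʳ (-‿inverseʳ x₀)) ⟩
      h zero + 0# * φ x₀           ≈⟨ +-congˡ (zeroˡ (φ x₀)) ⟩
      h zero + 0#                  ≈⟨ +-identityʳ (h zero) ⟩
      h zero                       ∎
    interpolates (suc i) with gap⁻¹ , gap*gap⁻¹ ← inverse _ (gap≉0 i) | correct ← proj₂ rest i = begin
      eval₁ (proj₁ result) (node (suc i))        ≈⟨ newton (node (suc i)) ⟩
      h zero + gap * φ (node (suc i))            ≈⟨ +-congˡ (*-congˡ correct) ⟩
      h zero + gap * (gap⁻¹ * (h (suc i) - h zero))  ≈⟨ +-congˡ (*-assoc _ _ _) ⟨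
      h zero + gap * gap⁻¹ * (h (suc i) - h zero)    ≈⟨ +-congˡ (trans (*-congʳ gap*gap⁻¹) (*-identityˡ _)) ⟩
      h zero + (h (suc i) - h zero)              ≈⟨ +-comm _ _ ⟩
      h (suc i) - h zero + h zero                ≈⟨ +-assoc _ _ _ ⟩
      h (suc i) + (- h zero + h zero)            ≈⟨ +-congˡ (-‿inverseˡ (h zero)) ⟩
      h (suc i) + 0#                             ≈⟨ +-identityʳ _ ⟩
      h (suc i)                                  ∎
      where
      gap : Carrier
      gap = node (suc i) - x₀

  eval-cong : (f : Polynomial F) → ∀ {x x′ y y′} → x ≈ x′ → y ≈ y′ → eval F f x y ≈ eval F f x′ y′
  eval-cong f x≈x′ y≈y′ = sum-cong-≋ {q} λ i → sum-cong-≋ {q} λ j →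
    *-congˡ {f i j} (*-cong (^-congˡ (toℕ i) x≈x′) (^-congˡ (toℕ j) y≈y′))

  -- Interpolate in X for each fixed value of Y, then interpolate every coefficient as a function of
  -- Y. Since `M` is not assumed to respect `≈`, agreement is claimed only at the representatives
  -- chosen by the enumeration.
  interpolation₂ : (M : Carrier → Carrier → Carrier) → ∃ λ (g : Polynomial F) →
    ∀ m n → eval F g (element F m) (element F n) ≈ M (element F m) (element F n)
  interpolation₂ M = g , interpolates
    where
    row : ∀ n → ∃ λ coeffs → ∀ m → eval₁ coeffs (element F m) ≈ M (element F m) (element F n)
    row n = interpolation q (element F) element-injective (λ m → M (element F m) (element F n))

    column : ∀ i → ∃ λ coeffs → ∀ n → eval₁ coeffs (element F n) ≈ proj₁ (row n) i
    column i = interpolation q (element F) element-injective (λ n → proj₁ (row n) i)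

    g : Polynomial F
    g i = proj₁ (column i)

    interpolates : ∀ m n → eval F g (element F m) (element F n) ≈ M (element F m) (element F n)
    interpolates m n = begin
      eval F g x y
        ≈⟨ sum-cong-≋ {q} (λ i → begin
             sum (λ j → g i j * (x ^ toℕ i * y ^ toℕ j))
               ≈⟨ sum-cong-≋ {q} (λ j → trans (*-congˡ (*-comm _ _)) (sym (*-assoc _ _ _))) ⟩
             sum (λ j → g i j * y ^ toℕ j * x ^ toℕ i)
               ≈⟨ *-distribʳ-sum (x ^ toℕ i) (λ j → g i j * y ^ toℕ j) ⟨
             eval₁ (g i) y * x ^ toℕ i
               ≈⟨ *-congʳ (proj₂ (column i) n) ⟩
             proj₁ (row n) i * x ^ toℕ i ∎) ⟩
      eval₁ (proj₁ (row n)) x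
        ≈⟨ proj₂ (row n) m ⟩
      M x y ∎
      where
      x = element F m
      y = element F n

  -- Latin families and the companion they define

  injective∧surjective⇒bijective : ∀ {φ : Carrier → Carrier} → (∀ {x y} → x ≈ y → φ x ≈ φ y) →
    (∀ {x y} → φ x ≈ φ y → x ≈ y) → (∀ y → ∃ λ x → φ x ≈ y) → Bijective _≈_ _≈_ φ
  injective∧surjective⇒bijective cong inj surj = inj , λ y →
    proj₁ (surj y) , λ z≈x → trans (cong z≈x) (proj₂ (surj y))

  -- `G₃` with the two generators abstracted; at `s = a`, `t = b` it unfolds to the same type.
  IsWord : ℕ → (s t : Carrier → Carrier) → (Carrier → Carrier) → Set (c ⊔ r)
  IsWord k s t g = ∃₂ λ j i → j ≤ 2 ℕ.* k ℕ.∸ 1 × i ≤ 1 × (∀ x → g x ≈ (t ^∘ j) ((s ^∘ i) x))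

  -- The rows of a Latin square: permutations of which exactly one sends a given x to a given y.
  -- Finiteness supplies the existence halves, so only injectivity is recorded.
  record LatinFamily (φ : Fin q → Carrier → Carrier) : Set (c ⊔ r) where
    field
      cong             : ∀ i {x y} → x ≈ y → φ i x ≈ φ i y
      injective        : ∀ i {x y} → φ i x ≈ φ i y → x ≈ y
      injective-index  : ∀ {i j} x → φ i x ≈ φ j x → i ≡ j

    solve : ∀ i y → ∃ λ x → φ i x ≈ y
    solve i = map-surjective (φ i) (injective i)

    solve-index : ∀ x y → ∃ λ i → φ i x ≈ y
    solve-index x = family-surjective (λ i → φ i x) (injective-index x)

  -- Latin `B` and `γ` make the cells (γ i u, δ i u) cover the plane exactly once, so that "the u of
  -- a cell" is a function. That the u-th transversal meets each line of fixed x once is the Latin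
  -- property of `γ`, and each line of fixed y that of `δ`. The map `m` allows `B` to list the group
  -- in another order than the tuple of `f`.
  companion : (f : Polynomial F) → IsLPP F f → (B γ δ : Fin q → Carrier → Carrier) →
    LatinFamily B → LatinFamily γ → LatinFamily δ →
    (∀ i u → B i (γ i u) ≈ δ i u) →
    (m : Fin q → Fin q) → (∀ {i j} → m i ≡ m j → i ≡ j) → (∀ i x → eval F f x (B i x) ≈ element F (m i)) →
    ∃ λ g → IsCompanion F f g
  companion f (_ , f-rows) B γ δ LB Lγ Lδ Bγ≈δ m m-injective f-on-B = g , lpp , orthogonal
    where
    module LB = LatinFamily LB
    module Lγ = LatinFamily Lγ
    module Lδ = LatinFamily Lδ

    cell : ∀ x y → ∃₂ λ i u → γ i u ≈ x × δ i u ≈ y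
    cell x y with i , Bx≈y ← LB.solve-index x y with u , γu≈x ← Lγ.solve i x =
      i , u , γu≈x , trans (sym (Bγ≈δ i u)) (trans (LB.cong i γu≈x) Bx≈y)

    M : Carrier → Carrier → Carrier
    M x y = proj₁ (proj₂ (cell x y))

    cell-unique : ∀ {i u j v} → γ i u ≈ γ j v → δ i u ≈ δ j v → i ≡ j × u ≈ v
    cell-unique {i} {u} {j} {v} γ≈ δ≈ with LB.injective-index (γ i u) (begin
      B i (γ i u)  ≈⟨ Bγ≈δ i u ⟩
      δ i u        ≈⟨ δ≈ ⟩
      δ j v        ≈⟨ Bγ≈δ j v ⟨
      B j (γ j v)  ≈⟨ LB.cong j γ≈ ⟨
      B j (γ i u)  ∎)
    ... | ≡.refl = ≡.refl , Lγ.injective i γ≈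

    g : Polynomial F
    g = proj₁ (interpolation₂ M)

    eval-g : ∀ i {u x y} → γ i u ≈ x → δ i u ≈ y → eval F g x y ≈ u
    eval-g i {u} {x} {y} γu≈x δu≈y = begin
      -- `M` may depend on the representative of a field element, so it is read at the canonical
      -- ones; `cell-unique` then shows that the cell chosen there carries the same u.
      eval F g x y    ≈⟨ eval-cong g (element-index x) (element-index y) ⟨
      eval F g x′ y′  ≈⟨ proj₂ (interpolation₂ M) (index x) (index y) ⟩
      M x′ y′         ≈⟨ proj₂ (cell-unique γ≈ δ≈) ⟩
      u               ∎
      where
      x′ = element F (index x)
      y′ = element F (index y)
      j = proj₁ (cell x′ y′)
      γ≈ = trans (proj₁ (proj₂ (proj₂ (cell x′ y′)))) (trans (element-index x) (sym γu≈x))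
      δ≈ = trans (proj₂ (proj₂ (proj₂ (cell x′ y′)))) (trans (element-index y) (sym δu≈y))

    same-column : ∀ {i u j v} → u ≈ v → δ i u ≈ δ j v → γ i u ≈ γ j v
    same-column {i} {u} {j} {v} u≈v δ≈ = trans (Lγ.cong i u≈v) (reflexive (≡.cong (λ i → γ i v)
      (Lδ.injective-index v (trans (Lδ.cong i (sym u≈v)) δ≈))))

    same-row : ∀ {i u j v} → u ≈ v → γ i u ≈ γ j v → δ i u ≈ δ j v
    same-row {i} {u} {j} {v} u≈v γ≈ = trans (Lδ.cong i u≈v) (reflexive (≡.cong (λ i → δ i v)
      (Lγ.injective-index v (trans (Lγ.cong i (sym u≈v)) γ≈))))

    columns-injective : ∀ y {x x′} → eval F g x y ≈ eval F g x′ y → x ≈ x′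
    columns-injective y {x} {x′} eq =
      let i , u , γu≈x  , δu≈y = cell x y
          j , v , γv≈x′ , δv≈y = cell x′ y
          u≈v = trans (sym (eval-g i γu≈x δu≈y)) (trans eq (eval-g j γv≈x′ δv≈y))
      in trans (sym γu≈x) (trans (same-column u≈v (trans δu≈y (sym δv≈y))) γv≈x′)

    columns-surjective : ∀ y u → ∃ λ x → eval F g x y ≈ u
    columns-surjective y u = let i , δu≈y = Lδ.solve-index u y in γ i u , eval-g i refl δu≈y

    rows-injective : ∀ x {y y′} → eval F g x y ≈ eval F g x y′ → y ≈ y′
    rows-injective x {y} {y′} eq =
      let i , u , γu≈x , δu≈y  = cell x y
          j , v , γv≈x , δv≈y′ = cell x y′
          u≈v = trans (sym (eval-g i γu≈x δu≈y)) (trans eq (eval-g j γv≈x δv≈y′))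
      in trans (sym δu≈y) (trans (same-row u≈v (trans γu≈x (sym γv≈x))) δv≈y′)

    rows-surjective : ∀ x u → ∃ λ y → eval F g x y ≈ u
    rows-surjective x u = let i , γu≈x = Lγ.solve-index u x in δ i u , eval-g i γu≈x refl

    lpp : IsLPP F g
    lpp = (λ y → injective∧surjective⇒bijective {λ x → eval F g x y}
                   (λ x≈x′ → eval-cong g x≈x′ refl) (columns-injective y) (columns-surjective y))
        , (λ x → injective∧surjective⇒bijective {λ y → eval F g x y}
                   (eval-cong g refl) (rows-injective x) (rows-surjective x))

    orthogonal : Orthogonal F f g
    orthogonal w u = (γ i u , δ i u) , (f-value , eval-g i refl refl) , unique
      where
      i : Fin q
      i = proj₁ (injective⇒surjective ≡.refl m m-injective (index w))

      f-at : ∀ x → eval F f x (B i x) ≈ w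
      f-at x = trans (f-on-B i x) (trans
        (reflexive (≡.cong (element F) (proj₂ (injective⇒surjective ≡.refl m m-injective (index w)))))
        (element-index w))

      f-value : eval F f (γ i u) (δ i u) ≈ w
      f-value = trans (eval-cong f refl (sym (Bγ≈δ i u))) (f-at (γ i u))

      unique : ∀ {xy} → eval F f (proj₁ xy) (proj₂ xy) ≈ w × eval F g (proj₁ xy) (proj₂ xy) ≈ u →
        γ i u ≈ proj₁ xy × δ i u ≈ proj₂ xy
      unique {x , y} (f≈w , g≈u) =
        let v , γv≈x = Lγ.solve i x
            -- Along a line of fixed x, `f` takes the value w only once, which forces the solution
            -- onto the graph of `B i`.
            y≈Bx = proj₁ (f-rows x) (trans f≈w (sym (f-at x)))
            δv≈y = trans (sym (Bγ≈δ i v)) (trans (LB.cong i γv≈x) (sym y≈Bx))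
            u≈v  = trans (sym g≈u) (eval-g i γv≈x δv≈y)
        in trans (Lγ.cong i u≈v) γv≈x , trans (Lδ.cong i u≈v) δv≈y

-- A complete mapping of the semidihedral group

module Semidihedral {c r : Level} (h₀ : ℕ) (F : FiniteField c r (4 ℕ.* (2 ℕ.* suc h₀))) where
  open FiniteField F using (Carrier; _≈_; setoid; refl; sym; trans; reflexive)
  open FieldTheory F
  open Endo Carrier using (_^_)
  open SetoidReasoning setoid

  private
    h k : ℕ
    h = suc h₀
    k = 2 ℕ.* h

  module Relations
    (a b : Carrier → Carrier)
    (a-cong : ∀ {x y} → x ≈ y → a x ≈ a y)
    (b-cong : ∀ {x y} → x ≈ y → b x ≈ b y)
    (a∘a : ∀ x → a (a x) ≈ x)
    (b^2k : ∀ x → (b ^ (2 ℕ.* k)) x ≈ x)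
    (b∘a∘b : ∀ x → b (a (b x)) ≈ (b ^ k) (a x))
    (exponent-unique : ∀ m n x → m < 2 ℕ.* k → n < 2 ℕ.* k → (b ^ m) x ≈ (b ^ n) x → m ≡ n)
    (cosets-disjoint : ∀ m n x → m < 2 ℕ.* k → n < 2 ℕ.* k → ¬ (b ^ m) x ≈ (b ^ n) (a x))
    where

    ^-cong : ∀ n {x y} → x ≈ y → (b ^ n) x ≈ (b ^ n) y
    ^-cong zero    x≈y = x≈y
    ^-cong (suc n) x≈y = b-cong (^-cong n x≈y)

    ^-+ : ∀ m n x → (b ^ (m ℕ.+ n)) x ≈ (b ^ m) ((b ^ n) x)
    ^-+ m n x = reflexive (≡.cong-app (Endo.^-homo Carrier b m n) x)

    ^-comm : ∀ m n x → (b ^ m) ((b ^ n) x) ≈ (b ^ n) ((b ^ m) x)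
    ^-comm m n x = begin
      (b ^ m) ((b ^ n) x)   ≈⟨ ^-+ m n x ⟨
      (b ^ (m ℕ.+ n)) x     ≡⟨ ≡.cong (λ e → (b ^ e) x) (ℕ.+-comm m n) ⟩
      (b ^ (n ℕ.+ m)) x     ≈⟨ ^-+ n m x ⟩
      (b ^ n) ((b ^ m) x)   ∎

    ^-≡ : ∀ {m n} x → m ≡ n → (b ^ m) x ≈ (b ^ n) x
    ^-≡ x ≡.refl = refl

    ^-period : ∀ n x → (b ^ (n ℕ.* (2 ℕ.* k))) x ≈ x
    ^-period zero    x = refl
    ^-period (suc n) x = begin
      (b ^ (2 ℕ.* k ℕ.+ n ℕ.* (2 ℕ.* k))) x         ≈⟨ ^-+ (2 ℕ.* k) (n ℕ.* (2 ℕ.* k)) x ⟩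
      (b ^ (2 ℕ.* k)) ((b ^ (n ℕ.* (2 ℕ.* k))) x)   ≈⟨ b^2k _ ⟩
      (b ^ (n ℕ.* (2 ℕ.* k))) x                     ≈⟨ ^-period n x ⟩
      x                                             ∎

    ^-% : ∀ n x → (b ^ (n % (2 ℕ.* k))) x ≈ (b ^ n) x
    ^-% n x = begin
      (b ^ (n % (2 ℕ.* k))) x
        ≈⟨ ^-cong (n % (2 ℕ.* k)) (^-period (n / (2 ℕ.* k)) x) ⟨
      (b ^ (n % (2 ℕ.* k))) ((b ^ (n / (2 ℕ.* k) ℕ.* (2 ℕ.* k))) x)
        ≈⟨ ^-+ (n % (2 ℕ.* k)) (n / (2 ℕ.* k) ℕ.* (2 ℕ.* k)) x ⟨
      (b ^ (n % (2 ℕ.* k) ℕ.+ n / (2 ℕ.* k) ℕ.* (2 ℕ.* k))) x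
        ≈⟨ ^-≡ x (≡.sym (m≡m%n+[m/n]*n n (2 ℕ.* k))) ⟩
      (b ^ n) x ∎

    ^-k-k : ∀ x → (b ^ k) ((b ^ k) x) ≈ x
    ^-k-k x = begin
      (b ^ k) ((b ^ k) x)        ≈⟨ ^-+ k k x ⟨
      (b ^ (k ℕ.+ k)) x          ≈⟨ ^-≡ x (≡.cong (k ℕ.+_) (ℕ.+-identityʳ k)) ⟨
      (b ^ (2 ℕ.* k)) x          ≈⟨ b^2k x ⟩
      x                          ∎

    b⁻¹ : Carrier → Carrier
    b⁻¹ = b ^ ℕ.pred (2 ℕ.* k)

    b⁻¹∘b : ∀ x → b⁻¹ (b x) ≈ x
    b⁻¹∘b x = trans (^-comm (ℕ.pred (2 ℕ.* k)) 1 x) (b^2k x)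

    b-injective : ∀ {x y} → b x ≈ b y → x ≈ y
    b-injective {x} {y} eq = trans (sym (b⁻¹∘b x)) (trans (^-cong (ℕ.pred (2 ℕ.* k)) eq) (b⁻¹∘b y))

    ^-injective : ∀ n {x y} → (b ^ n) x ≈ (b ^ n) y → x ≈ y
    ^-injective zero    eq = eq
    ^-injective (suc n) eq = ^-injective n (b-injective eq)

    a-injective : ∀ {x y} → a x ≈ a y → x ≈ y
    a-injective {x} {y} eq = trans (sym (a∘a x)) (trans (a-cong eq) (a∘a y))

    -- Two uses of bab = bᵏa produce bᵏbᵏ = 1, so a inverts b², and with it every even power of b.
    b²∘a∘b² : ∀ x → (b ^ 2) (a ((b ^ 2) x)) ≈ a x
    b²∘a∘b² x = begin
      b (b (a (b (b x))))          ≈⟨ b-cong (b∘a∘b (b x)) ⟩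
      b ((b ^ k) (a (b x)))        ≈⟨ ^-comm 1 k (a (b x)) ⟩
      (b ^ k) (b (a (b x)))        ≈⟨ ^-cong k (b∘a∘b x) ⟩
      (b ^ k) ((b ^ k) (a x))      ≈⟨ ^-k-k (a x) ⟩
      a x                          ∎

    even-conjugation : ∀ j x → (b ^ (2 ℕ.* j)) (a ((b ^ (2 ℕ.* j)) x)) ≈ a x
    even-conjugation zero    x = refl
    even-conjugation (suc j) x = begin
      (b ^ (2 ℕ.* suc j)) (a ((b ^ (2 ℕ.* suc j)) x))
        ≈⟨ ^-≡ _ (ℕ.*-suc 2 j) ⟩
      (b ^ 2) ((b ^ (2 ℕ.* j)) (a ((b ^ (2 ℕ.* suc j)) x)))
        ≈⟨ ^-comm 2 (2 ℕ.* j) _ ⟩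
      (b ^ (2 ℕ.* j)) ((b ^ 2) (a ((b ^ (2 ℕ.* suc j)) x)))
        ≈⟨ ^-cong (2 ℕ.* j) (^-cong 2 (a-cong (^-≡ x (ℕ.*-suc 2 j)))) ⟩
      (b ^ (2 ℕ.* j)) ((b ^ 2) (a ((b ^ 2) ((b ^ (2 ℕ.* j)) x))))
        ≈⟨ ^-cong (2 ℕ.* j) (b²∘a∘b² _) ⟩
      (b ^ (2 ℕ.* j)) (a ((b ^ (2 ℕ.* j)) x))
        ≈⟨ even-conjugation j x ⟩
      a x ∎

    odd-conjugation : ∀ j x → (b ^ suc (2 ℕ.* j)) (a ((b ^ suc (2 ℕ.* j)) x)) ≈ (b ^ k) (a x)
    odd-conjugation j x = begin
      b ((b ^ (2 ℕ.* j)) (a (b ((b ^ (2 ℕ.* j)) x))))   ≈⟨ b-cong (^-cong (2 ℕ.* j) (a-cong (^-comm 1 (2 ℕ.* j) x))) ⟩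
      b ((b ^ (2 ℕ.* j)) (a ((b ^ (2 ℕ.* j)) (b x))))   ≈⟨ b-cong (even-conjugation j (b x)) ⟩
      b (a (b x))                                       ≈⟨ b∘a∘b x ⟩
      (b ^ k) (a x)                                     ∎

    -- From bab = bᵏa comes ab = b⁻¹bᵏa, and iteration moves a past any power. Only the existence of
    -- the new exponent matters, so it is left unreduced.
    a∘^ : ∀ n → ∃ λ n′ → ∀ x → a ((b ^ n) x) ≈ (b ^ n′) (a x)
    a∘^ zero    = 0 , λ x → refl
    a∘^ (suc n) = let n′ , a∘bⁿ = a∘^ n in ℕ.pred (2 ℕ.* k) ℕ.+ (k ℕ.+ n′) , λ x → begin
      a (b ((b ^ n) x))                     ≈⟨ b⁻¹∘b _ ⟨
      b⁻¹ (b (a (b ((b ^ n) x))))           ≈⟨ ^-cong (ℕ.pred (2 ℕ.* k)) (begin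
        b (a (b ((b ^ n) x)))                 ≈⟨ b∘a∘b _ ⟩
        (b ^ k) (a ((b ^ n) x))               ≈⟨ ^-cong k (a∘bⁿ x) ⟩
        (b ^ k) ((b ^ n′) (a x))              ≈⟨ ^-+ k n′ (a x) ⟨
        (b ^ (k ℕ.+ n′)) (a x)                ∎) ⟩
      b⁻¹ ((b ^ (k ℕ.+ n′)) (a x))          ≈⟨ ^-+ (ℕ.pred (2 ℕ.* k)) (k ℕ.+ n′) (a x) ⟨
      (b ^ (ℕ.pred (2 ℕ.* k) ℕ.+ (k ℕ.+ n′))) (a x)  ∎

    exponent-unique-% : ∀ m n x → (b ^ m) x ≈ (b ^ n) x → m % (2 ℕ.* k) ≡ n % (2 ℕ.* k)
    exponent-unique-% m n x eq = exponent-unique (m % (2 ℕ.* k)) (n % (2 ℕ.* k)) x (m%n<n m _) (m%n<n n _)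
      (trans (^-% m x) (trans eq (sym (^-% n x))))

    -- Powers of b that agree at one point have exponents congruent modulo 2k, hence modulo 2.
    parity-unique : ∀ m n x → ¬ (b ^ suc (2 ℕ.* m)) x ≈ (b ^ (2 ℕ.* n)) x
    parity-unique m n x eq = contradiction parity λ ()
      where
      2k% : ∀ e → e % (2 ℕ.* k) % 2 ≡ e % 2
      2k% e = m∣n⇒o%n%m≡o%m 2 (2 ℕ.* k) e (divides k (ℕ.*-comm 2 k))

      even : ∀ n → (2 ℕ.* n) % 2 ≡ 0
      even n = ≡.trans (%-congˡ {o = 2} (ℕ.*-comm 2 n)) (m*n%n≡0 n 2)

      parity : 1 ≡ 0
      parity = ≡.trans (≡.sym ([m+kn]%n≡m%n 1 m 2)) (≡.trans (%-congˡ {o = 2} (≡.cong suc (ℕ.*-comm m 2)))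
        (≡.trans (≡.sym (2k% (suc (2 ℕ.* m)))) (≡.trans (%-congˡ {o = 2} (exponent-unique-% (suc (2 ℕ.* m)) (2 ℕ.* n) x eq))
        (≡.trans (2k% (2 ℕ.* n)) (even n)))))

    ^≉^∘a : ∀ m n x → ¬ (b ^ m) x ≈ (b ^ n) (a x)
    ^≉^∘a m n x eq = cosets-disjoint (m % (2 ℕ.* k)) (n % (2 ℕ.* k)) x (m%n<n m _) (m%n<n n _)
      (trans (^-% m x) (trans eq (sym (^-% n (a x)))))

    ^≉a∘^ : ∀ m n x → ¬ (b ^ m) x ≈ a ((b ^ n) x)
    ^≉a∘^ m n x eq = let n′ , a∘bⁿ = a∘^ n in ^≉^∘a m n′ x (trans eq (a∘bⁿ x))

    -- The complete mapping β ↦ γ with products δ = βγ: four pieces, each indexed by j < k.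
    β γ δ : Fin 4 → ℕ → Carrier → Carrier
    β 0F j x = (b ^ j) x
    β 1F j x = (b ^ (k ℕ.+ j)) x
    β 2F j x = a ((b ^ (k ℕ.+ j)) x)
    β 3F j x = a ((b ^ j) x)

    γ 0F j x = (b ^ j) x
    γ 1F j x = (b ^ suc (k ℕ.+ j)) (a x)
    γ 2F j x = (b ^ (k ℕ.+ j)) x
    γ 3F j x = (b ^ suc j) (a x)

    δ 0F j x = (b ^ (2 ℕ.* j)) x
    δ 1F j x = (b ^ suc (2 ℕ.* j)) (a x)
    δ 2F j x = a ((b ^ (2 ℕ.* j)) x)
    δ 3F j x = a ((b ^ suc (2 ℕ.* j)) (a x))

    ^-^ : ∀ m n {o} x → m ℕ.+ n ≡ o → (b ^ m) ((b ^ n) x) ≈ (b ^ o) x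
    ^-^ m n x m+n≡o = trans (sym (^-+ m n x)) (^-≡ x m+n≡o)

    -- Doubling cannot tell j from k + j modulo 2k: in pieces `1F` and `2F` a full period splits off
    -- and vanishes. The extra `suc` in pieces `1F` and `3F` is what makes those products odd.
    β∘γ≈δ : ∀ p j x → β p j (γ p j x) ≈ δ p j x
    β∘γ≈δ 0F j x = ^-^ j j x (solve j)
      where
      solve : ∀ j → j ℕ.+ j ≡ 2 ℕ.* j
      solve = solve-∀
    β∘γ≈δ 1F j x = trans (^-^ (k ℕ.+ j) _ (a x) (solve k j)) (trans (^-+ (2 ℕ.* k) _ (a x)) (b^2k _))
      where
      solve : ∀ k j → (k ℕ.+ j) ℕ.+ suc (k ℕ.+ j) ≡ 2 ℕ.* k ℕ.+ suc (2 ℕ.* j)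
      solve = solve-∀
    β∘γ≈δ 2F j x = a-cong (trans (^-^ (k ℕ.+ j) _ x (solve k j)) (trans (^-+ (2 ℕ.* k) _ x) (b^2k _)))
      where
      solve : ∀ k j → (k ℕ.+ j) ℕ.+ (k ℕ.+ j) ≡ 2 ℕ.* k ℕ.+ 2 ℕ.* j
      solve = solve-∀
    β∘γ≈δ 3F j x = a-cong (^-^ j (suc j) (a x) (solve j))
      where
      solve : ∀ j → j ℕ.+ suc j ≡ suc (2 ℕ.* j)
      solve = solve-∀

    low<2k : ∀ {j} → j < k → j < 2 ℕ.* k
    low<2k j<k = ℕ.<-≤-trans j<k (ℕ.m≤m+n k _)

    high<2k : ∀ {j} → j < k → k ℕ.+ j < 2 ℕ.* k
    high<2k j<k = ℕ.<-≤-trans (ℕ.+-monoʳ-< k j<k) (ℕ.≤-reflexive (≡.cong (k ℕ.+_) (≡.sym (ℕ.+-identityʳ k))))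

    Separating : (ℕ → Carrier → Carrier) → Set _
    Separating φ = ∀ i j x → i < k → j < k → φ i x ≈ φ j x → i ≡ j

    Disjoint : (φ ψ : ℕ → Carrier → Carrier) → Set _
    Disjoint φ ψ = ∀ i j x → i < k → j < k → ¬ φ i x ≈ ψ j x

    low-separating : Separating (b ^_)
    low-separating i j x i<k j<k = exponent-unique i j x (low<2k i<k) (low<2k j<k)

    high-separating : Separating (λ j → b ^ (k ℕ.+ j))
    high-separating i j x i<k j<k eq =
      ℕ.+-cancelˡ-≡ k i j (exponent-unique (k ℕ.+ i) (k ℕ.+ j) x (high<2k i<k) (high<2k j<k) eq)

    double-separating : Separating (λ j → b ^ (2 ℕ.* j))
    double-separating i j x i<k j<k eq = ℕ.*-cancelˡ-≡ i j 2
      (exponent-unique (2 ℕ.* i) (2 ℕ.* j) x (ℕ.*-monoʳ-< 2 i<k) (ℕ.*-monoʳ-< 2 j<k) eq)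

    low-high-disjoint : Disjoint (b ^_) (λ j → b ^ (k ℕ.+ j))
    low-high-disjoint i j x i<k j<k eq =
      ℕ.m+n≮m k j (≡.subst (_< k) (exponent-unique i (k ℕ.+ j) x (low<2k i<k) (high<2k j<k) eq) i<k)

    piece : Fin (4 ℕ.* k) → Fin 4
    piece i = proj₁ (remQuot k i)

    offset : Fin (4 ℕ.* k) → ℕ
    offset i = toℕ (proj₂ (remQuot {4} k i))

    latin : (φ : Fin 4 → ℕ → Carrier → Carrier) →
      (∀ p j {x y} → x ≈ y → φ p j x ≈ φ p j y) →
      (∀ p j {x y} → φ p j x ≈ φ p j y → x ≈ y) →
      (∀ p → Separating (φ p)) →
      Disjoint (φ 0F) (φ 1F) → Disjoint (φ 0F) (φ 2F) → Disjoint (φ 0F) (φ 3F) →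
      Disjoint (φ 1F) (φ 2F) → Disjoint (φ 1F) (φ 3F) → Disjoint (φ 2F) (φ 3F) →
      LatinFamily (λ i → φ (piece i) (offset i))
    latin φ φ-cong φ-injective separating 0#1 0#2 0#3 1#2 1#3 2#3 = record
      { cong            = λ i → φ-cong (piece i) (offset i)
      ; injective       = λ i → φ-injective (piece i) (offset i)
      ; injective-index = λ {i} {j} x eq →
          let same-piece , same-offset =
                index-unique (piece i) (piece j) (offset i) (offset j) x (toℕ<n _) (toℕ<n _) eq in
          ≡.trans (≡.sym (combine-remQuot {4} k i))
            (≡.trans (≡.cong₂ combine same-piece (toℕ-injective same-offset)) (combine-remQuot {4} k j))
      }
      where
      index-unique : ∀ p p′ i j x → i < k → j < k → φ p i x ≈ φ p′ j x → p ≡ p′ × i ≡ j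
      index-unique 0F 0F i j x i<k j<k eq = ≡.refl , separating 0F i j x i<k j<k eq
      index-unique 1F 1F i j x i<k j<k eq = ≡.refl , separating 1F i j x i<k j<k eq
      index-unique 2F 2F i j x i<k j<k eq = ≡.refl , separating 2F i j x i<k j<k eq
      index-unique 3F 3F i j x i<k j<k eq = ≡.refl , separating 3F i j x i<k j<k eq
      index-unique 0F 1F i j x i<k j<k eq = contradiction eq (0#1 i j x i<k j<k)
      index-unique 0F 2F i j x i<k j<k eq = contradiction eq (0#2 i j x i<k j<k)
      index-unique 0F 3F i j x i<k j<k eq = contradiction eq (0#3 i j x i<k j<k)
      index-unique 1F 2F i j x i<k j<k eq = contradiction eq (1#2 i j x i<k j<k)
      index-unique 1F 3F i j x i<k j<k eq = contradiction eq (1#3 i j x i<k j<k)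
      index-unique 2F 3F i j x i<k j<k eq = contradiction eq (2#3 i j x i<k j<k)
      index-unique 1F 0F i j x i<k j<k eq = contradiction (sym eq) (0#1 j i x j<k i<k)
      index-unique 2F 0F i j x i<k j<k eq = contradiction (sym eq) (0#2 j i x j<k i<k)
      index-unique 3F 0F i j x i<k j<k eq = contradiction (sym eq) (0#3 j i x j<k i<k)
      index-unique 2F 1F i j x i<k j<k eq = contradiction (sym eq) (1#2 j i x j<k i<k)
      index-unique 3F 1F i j x i<k j<k eq = contradiction (sym eq) (1#3 j i x j<k i<k)
      index-unique 3F 2F i j x i<k j<k eq = contradiction (sym eq) (2#3 j i x j<k i<k)

    β-latin : LatinFamily _
    β-latin = latin β
      (λ { 0F j → ^-cong j ; 1F j → ^-cong (k ℕ.+ j)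
         ; 2F j x≈y → a-cong (^-cong (k ℕ.+ j) x≈y) ; 3F j x≈y → a-cong (^-cong j x≈y) })
      (λ { 0F j → ^-injective j ; 1F j → ^-injective (k ℕ.+ j)
         ; 2F j eq → ^-injective (k ℕ.+ j) (a-injective eq) ; 3F j eq → ^-injective j (a-injective eq) })
      (λ { 0F → low-separating
         ; 1F → high-separating
         ; 2F i j x i<k j<k eq → high-separating i j x i<k j<k (a-injective eq)
         ; 3F i j x i<k j<k eq → low-separating i j x i<k j<k (a-injective eq) })
      low-high-disjoint
      (λ i j x _ _ → ^≉a∘^ i (k ℕ.+ j) x)
      (λ i j x _ _ → ^≉a∘^ i j x)
      (λ i j x _ _ → ^≉a∘^ (k ℕ.+ i) (k ℕ.+ j) x)
      (λ i j x _ _ → ^≉a∘^ (k ℕ.+ i) j x)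
      (λ i j x i<k j<k eq → low-high-disjoint j i x j<k i<k (sym (a-injective eq)))

    -- Pieces `0F` and `2F` are the low and high halves of ⟨b⟩; pieces `3F` and `1F`, after
    -- cancelling one b, are the low and high halves of ⟨b⟩a.
    γ-latin : LatinFamily _
    γ-latin = latin γ
      (λ { 0F j → ^-cong j ; 1F j x≈y → ^-cong (suc (k ℕ.+ j)) (a-cong x≈y)
         ; 2F j → ^-cong (k ℕ.+ j) ; 3F j x≈y → ^-cong (suc j) (a-cong x≈y) })
      (λ { 0F j → ^-injective j ; 1F j eq → a-injective (^-injective (suc (k ℕ.+ j)) eq)
         ; 2F j → ^-injective (k ℕ.+ j) ; 3F j eq → a-injective (^-injective (suc j) eq) })
      (λ { 0F → low-separating
         ; 1F i j x i<k j<k eq → high-separating i j (a x) i<k j<k (b-injective eq)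
         ; 2F → high-separating
         ; 3F i j x i<k j<k eq → low-separating i j (a x) i<k j<k (b-injective eq) })
      (λ i j x _ _ → ^≉^∘a i (suc (k ℕ.+ j)) x)
      low-high-disjoint
      (λ i j x _ _ → ^≉^∘a i (suc j) x)
      (λ i j x _ _ eq → ^≉^∘a (k ℕ.+ j) (suc (k ℕ.+ i)) x (sym eq))
      (λ i j x i<k j<k eq → low-high-disjoint j i (a x) j<k i<k (sym (b-injective eq)))
      (λ i j x _ _ → ^≉^∘a (k ℕ.+ i) (suc j) x)

    -- Pieces `0F` and `3F` are the even and the odd powers of b, pieces `2F` and `1F` the even and
    -- the odd words of ⟨b⟩a. The cross pairs lie in different cosets; the two pairs within a coset
    -- need parity.
    δ-latin : LatinFamily _
    δ-latin = latin δ
      (λ { 0F j → ^-cong (2 ℕ.* j) ; 1F j x≈y → ^-cong (suc (2 ℕ.* j)) (a-cong x≈y)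
         ; 2F j x≈y → a-cong (^-cong (2 ℕ.* j) x≈y) ; 3F j x≈y → a-cong (^-cong (suc (2 ℕ.* j)) (a-cong x≈y)) })
      (λ { 0F j → ^-injective (2 ℕ.* j) ; 1F j eq → a-injective (^-injective (suc (2 ℕ.* j)) eq)
         ; 2F j eq → ^-injective (2 ℕ.* j) (a-injective eq)
         ; 3F j eq → a-injective (^-injective (suc (2 ℕ.* j)) (a-injective eq)) })
      (λ { 0F → double-separating
         ; 1F i j x i<k j<k eq → double-separating i j (a x) i<k j<k (b-injective eq)
         ; 2F i j x i<k j<k eq → double-separating i j x i<k j<k (a-injective eq)
         ; 3F i j x i<k j<k eq → double-separating i j (a x) i<k j<k (b-injective (a-injective eq)) })
      (λ i j x _ _ → ^≉^∘a (2 ℕ.* i) (suc (2 ℕ.* j)) x)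
      (λ i j x _ _ → ^≉a∘^ (2 ℕ.* i) (2 ℕ.* j) x)
      0#3
      1#2
      (λ i j x _ _ → ^≉a∘^ (suc (2 ℕ.* i)) (suc (2 ℕ.* j)) (a x))
      (λ i j x _ _ eq → ^≉^∘a (2 ℕ.* i) (suc (2 ℕ.* j)) x (a-injective eq))
      where
      -- Applying b to the power 2j + 1 on both sides turns the right one into bᵏ by
      -- `odd-conjugation`. The left exponent is odd and k = 2h is even; this is where the evenness
      -- of k decides.
      0#3 : Disjoint (δ 0F) (δ 3F)
      0#3 i j x _ _ eq = parity-unique (j ℕ.+ i) h x (begin
        (b ^ suc (2 ℕ.* (j ℕ.+ i))) x
          ≈⟨ ^-^ (suc (2 ℕ.* j)) (2 ℕ.* i) x (≡.cong suc (≡.sym (ℕ.*-distribˡ-+ 2 j i))) ⟨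
        (b ^ suc (2 ℕ.* j)) ((b ^ (2 ℕ.* i)) x)
          ≈⟨ ^-cong (suc (2 ℕ.* j)) eq ⟩
        (b ^ suc (2 ℕ.* j)) (a ((b ^ suc (2 ℕ.* j)) (a x)))
          ≈⟨ odd-conjugation j (a x) ⟩
        (b ^ k) (a (a x))
          ≈⟨ ^-cong k (a∘a x) ⟩
        (b ^ k) x ∎)

      -- Applying b to the power 2j clears the right side by `even-conjugation`, leaving an odd
      -- power of b that would fix `a x`.
      1#2 : Disjoint (δ 1F) (δ 2F)
      1#2 i j x _ _ eq = parity-unique (i ℕ.+ j) 0 (a x) (begin
        (b ^ suc (2 ℕ.* (i ℕ.+ j))) (a x)
          ≈⟨ ^-^ (suc (2 ℕ.* i)) (2 ℕ.* j) (a x) (≡.cong suc (≡.sym (ℕ.*-distribˡ-+ 2 i j))) ⟨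
        (b ^ suc (2 ℕ.* i)) ((b ^ (2 ℕ.* j)) (a x))
          ≈⟨ ^-comm (suc (2 ℕ.* i)) (2 ℕ.* j) (a x) ⟩
        (b ^ (2 ℕ.* j)) ((b ^ suc (2 ℕ.* i)) (a x))
          ≈⟨ ^-cong (2 ℕ.* j) eq ⟩
        (b ^ (2 ℕ.* j)) (a ((b ^ (2 ℕ.* j)) x))
          ≈⟨ even-conjugation j x ⟩
        a x ∎)

    ^-word : ∀ n → IsWord k a b (b ^ n)
    ^-word n = n % (2 ℕ.* k) , 0 , ℕ.s≤s⁻¹ (m%n<n n (2 ℕ.* k)) , z≤n , λ x → sym (^-% n x)

    a∘^-word : ∀ n → IsWord k a b (λ x → a ((b ^ n) x))
    a∘^-word n = let n′ , a∘bⁿ = a∘^ n in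
      n′ % (2 ℕ.* k) , 1 , ℕ.s≤s⁻¹ (m%n<n n′ (2 ℕ.* k)) , s≤s z≤n , λ x → trans (a∘bⁿ x) (sym (^-% n′ (a x)))

    β-word : ∀ p j → IsWord k a b (β p j)
    β-word 0F j = ^-word j
    β-word 1F j = ^-word (k ℕ.+ j)
    β-word 2F j = a∘^-word (k ℕ.+ j)
    β-word 3F j = a∘^-word j

-- Evaluation of cycle notation

module _ {c r : Level} {q : ℕ} (F : FiniteField c r q) where
  open ≡ using (refl; sym; trans; cong; subst)
  open FiniteField F using (Carrier; _≈_)
  open FieldTheory F using (element-injective; index; element-index)

  elementℕ-toℕ : ∀ i → elementℕ F (toℕ i) ≡ element F i
  elementℕ-toℕ i = cong (element F) (toℕ-injective (trans (toℕ-fromℕ< _) (m<n⇒m%n≡m (toℕ<n i))))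
    where instance _ = nonZeroIndex (index (FiniteField.0# F))

  elementℕ-injective : ∀ {m n} → m < q → n < q → elementℕ F m ≈ elementℕ F n → m ≡ n
  elementℕ-injective {m} {n} m<q n<q eq = fromℕ<-injective m n m<q n<q (element-injective
    (≡.subst₂ _≈_ (elementℕ-fromℕ< m<q) (elementℕ-fromℕ< n<q) eq))
    where
    elementℕ-fromℕ< : ∀ {m} (m<q : m < q) → elementℕ F m ≡ element F (fromℕ< m<q)
    elementℕ-fromℕ< m<q =
      trans (cong (elementℕ F) (sym (toℕ-fromℕ< m<q))) (elementℕ-toℕ (fromℕ< m<q))

  cycle-fixes : ∀ {x} es → All (λ e → ¬ x ≈ e) es → cycle F es x ≡ x
  cycle-fixes []       _         = refl
  cycle-fixes {x} (h ∷ es) x≉es = go-fixes h es x≉es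
    where
    go-fixes : ∀ e es′ → All (λ e → ¬ x ≈ e) (e ∷ es′) → Cycle.go F h es x e es′ ≡ x
    go-fixes e [] (x≉e ∷ _) with decEq F x e
    ... | yes x≈e = contradiction x≈e x≉e
    ... | no  _   = refl
    go-fixes e (e′ ∷ es′) (x≉e ∷ x≉es′) with decEq F x e
    ... | yes x≈e = contradiction x≈e x≉e
    ... | no  _   = go-fixes e′ es′ x≉es′

  -- Since σ is a function, repetitions in the list are harmless and need not be excluded.
  cycle-follows : ∀ {t} {T : Set t} (σ : T → T) (enc : T → Carrier) (h : T) (es : List T) →
    Linked (λ s t → σ s ≡ t) ((h ∷ es) ++ [ h ]) →
    ∀ {t} → (∀ {e} → e ∈ h ∷ es → enc t ≈ enc e → t ≡ e) → t ∈ h ∷ es →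
    cycle F (map enc (h ∷ es)) (enc t) ≡ enc (σ t)
  cycle-follows {T = T} σ enc h es linked {t} injective = go-follows h es linked injective
    where
    open FiniteField F using () renaming (refl to ≈-refl)

    go-follows : ∀ e es′ → Linked (λ s t → σ s ≡ t) ((e ∷ es′) ++ [ h ]) →
      (∀ {e′} → e′ ∈ e ∷ es′ → enc t ≈ enc e′ → t ≡ e′) → t ∈ e ∷ es′ →
      Cycle.go F (enc h) (map enc es) (enc t) (enc e) (map enc es′) ≡ enc (σ t)
    -- The list in the `Linked` hypothesis ends with `h`, so the return from the last entry to the
    -- first is an ordinary link.
    go-follows e [] (refl ∷ _) inj (here refl) with decEq F (enc t) (enc t)
    ... | yes _   = refl
    ... | no  t≉t = contradiction ≈-refl t≉t
    go-follows e (e′ ∷ es′) (σe≡e′ ∷ linked′) inj t∈ with decEq F (enc t) (enc e) | t∈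
    ... | yes t≈e | _            = cong enc (trans (sym σe≡e′) (cong σ (sym (inj (here refl) t≈e))))
    ... | no  t≉e | here refl    = contradiction ≈-refl t≉e
    ... | no  _   | there t∈es′  = go-follows e′ es′ linked′ (inj ∘ there) t∈es′

  -- The product of transpositions `a`

  private
    transposition : ℕ → Carrier → Carrier
    transposition i = cycle F (elementℕ F (2 ℕ.* i) ∷ elementℕ F (2 ℕ.* i ℕ.+ 1) ∷ [])

    -- At `upTo (q / 2)` this unfolds to `a`; arbitrary index lists are allowed for the sake of
    -- induction.
    product : List ℕ → Carrier → Carrier
    product is = foldr _∘_ id (map (λ i → transposition i) is)

  -- The two entries of the m-th transposition in either order, so that one statement covers both
  -- directions of the swap.
  data Matched (m : ℕ) : ℕ → ℕ → Set where
    even-odd : Matched m (2 ℕ.* m) (2 ℕ.* m ℕ.+ 1)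
    odd-even : Matched m (2 ℕ.* m ℕ.+ 1) (2 ℕ.* m)

  matched-sym : ∀ {m s t} → Matched m s t → Matched m t s
  matched-sym even-odd = odd-even
  matched-sym odd-even = even-odd

  module _ (q-even : q ≡ q / 2 ℕ.* 2) where
    even<q : ∀ {m} → m < q / 2 → 2 ℕ.* m < q
    even<q {m} m<q/2 = subst (2 ℕ.* m <_) (trans (ℕ.*-comm 2 (q / 2)) (sym q-even)) (ℕ.*-monoʳ-< 2 m<q/2)

    odd<q : ∀ {m} → m < q / 2 → 2 ℕ.* m ℕ.+ 1 < q
    odd<q {m} m<q/2 = begin-strict
      2 ℕ.* m ℕ.+ 1  <⟨ ℕ.+-monoʳ-< (2 ℕ.* m) (ℕ.n<1+n 1) ⟩
      2 ℕ.* m ℕ.+ 2  ≡⟨ ℕ.+-comm (2 ℕ.* m) 2 ⟩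
      2 ℕ.+ 2 ℕ.* m  ≡⟨ ℕ.*-suc 2 m ⟨
      2 ℕ.* suc m    ≤⟨ ℕ.*-monoʳ-≤ 2 m<q/2 ⟩
      2 ℕ.* (q / 2)  ≡⟨ ℕ.*-comm 2 (q / 2) ⟩
      q / 2 ℕ.* 2    ≡⟨ q-even ⟨
      q              ∎
      where open ℕ.≤-Reasoning

    odd≢even : ∀ m n → 2 ℕ.* m ℕ.+ 1 ≢ 2 ℕ.* n
    odd≢even m n eq = ℕ.even≢odd n m (trans (sym eq) (ℕ.+-comm (2 ℕ.* m) 1))

    transposition-swaps : ∀ {m s t} → m < q / 2 → Matched m s t →
      transposition m (elementℕ F s) ≡ elementℕ F t
    transposition-swaps {m} m<q/2 even-odd with decEq F (elementℕ F (2 ℕ.* m)) (elementℕ F (2 ℕ.* m))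
    ... | yes _ = refl
    ... | no  s≉s = contradiction (FiniteField.refl F) s≉s
    transposition-swaps {m} m<q/2 odd-even
      with decEq F (elementℕ F (2 ℕ.* m ℕ.+ 1)) (elementℕ F (2 ℕ.* m))
         | decEq F (elementℕ F (2 ℕ.* m ℕ.+ 1)) (elementℕ F (2 ℕ.* m ℕ.+ 1))
    ... | yes s≈t | _       = contradiction (elementℕ-injective (odd<q m<q/2) (even<q m<q/2) s≈t) (odd≢even m m)
    ... | no  _   | yes _   = refl
    ... | no  _   | no  s≉s = contradiction (FiniteField.refl F) s≉s

    transposition-fixes : ∀ {i m s t} → i < q / 2 → m < q / 2 → i ≢ m → Matched m s t →
      transposition i (elementℕ F s) ≡ elementℕ F s
    transposition-fixes {i} {m} i<q/2 m<q/2 i≢m even-odd = cycle-fixes _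
      ( (λ eq → i≢m (sym (ℕ.*-cancelˡ-≡ m i 2 (elementℕ-injective (even<q m<q/2) (even<q i<q/2) eq))))
      ∷ (λ eq → odd≢even i m (sym (elementℕ-injective (even<q m<q/2) (odd<q i<q/2) eq)))
      ∷ [])
    transposition-fixes {i} {m} i<q/2 m<q/2 i≢m odd-even = cycle-fixes _
      ( (λ eq → odd≢even m i (elementℕ-injective (odd<q m<q/2) (even<q i<q/2) eq))
      ∷ (λ eq → i≢m (sym (ℕ.*-cancelˡ-≡ m i 2
          (ℕ.+-cancelʳ-≡ 1 _ _ (elementℕ-injective (odd<q m<q/2) (odd<q i<q/2) eq)))))
      ∷ [])

    product-fixes : ∀ {m s t} is → All (_< q / 2) is → m < q / 2 → All (_≢ m) is → Matched m s t →
      product is (elementℕ F s) ≡ elementℕ F s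
    product-fixes []       []                _     _             _   = refl
    product-fixes (i ∷ is) (i<q/2 ∷ is<q/2) m<q/2 (i≢m ∷ is≢m) s~t =
      trans (cong (transposition i) (product-fixes is is<q/2 m<q/2 is≢m s~t))
            (transposition-fixes i<q/2 m<q/2 i≢m s~t)

    -- Composition runs right to left: the transpositions after the m-th in the list act first and
    -- fix s, those before it act last and fix t.
    product-swaps : ∀ {m s t} is → All (_< q / 2) is → Unique is → m ∈ is → Matched m s t →
      product is (elementℕ F s) ≡ elementℕ F t
    product-swaps (m ∷ is) (m<q/2 ∷ is<q/2) (m≢is ∷ _) (here refl) s~t =
      trans (cong (transposition m)
              (product-fixes is is<q/2 m<q/2 (All.map (λ m≢i i≡m → m≢i (sym i≡m)) m≢is) s~t))
            (transposition-swaps m<q/2 s~t)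
    product-swaps (i ∷ is) (i<q/2 ∷ is<q/2) (i≢is ∷ unique) (there m∈is) s~t =
      trans (cong (transposition i) (product-swaps is is<q/2 unique m∈is s~t))
            (transposition-fixes i<q/2 (All.lookup is<q/2 m∈is) (All.lookup i≢is m∈is) (matched-sym s~t))

    a-swaps : ∀ {m s t} → m < q / 2 → Matched m s t → a F (elementℕ F s) ≡ elementℕ F t
    a-swaps m<q/2 = product-swaps (upTo (q / 2)) (All.tabulate ∈-upTo⁻) (upTo⁺ (q / 2)) (∈-upTo⁺ m<q/2)

-- The cycles of b in coordinates

module _ {x} {X : Set x} where
  open ≡ using (refl; cong₂)

  pairs : (A B : ℕ → X) → List ℕ → List X
  pairs A B = concatMap (λ i → A i ∷ B i ∷ [])

  map-pairs : ∀ {y} {Y : Set y} (g : X → Y) (A B : ℕ → X) {A′ B′ : ℕ → Y} is →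
    (∀ {i} → i ∈ is → A′ i ≡ g (A i)) → (∀ {i} → i ∈ is → B′ i ≡ g (B i)) →
    concatMap (λ i → A′ i ∷ B′ i ∷ []) is ≡ map g (pairs A B is)
  map-pairs g A B []       eqA eqB = refl
  map-pairs g A B (i ∷ is) eqA eqB = cong₂ _∷_ (eqA (here refl))
    (cong₂ _∷_ (eqB (here refl)) (map-pairs g A B is (eqA ∘ there) (eqB ∘ there)))

  all-pairs : ∀ {p} {P : X → Set p} {A B : ℕ → X} is →
    (∀ {i} → i ∈ is → P (A i)) → (∀ {i} → i ∈ is → P (B i)) → All P (pairs A B is)
  all-pairs []       allA allB = []
  all-pairs (i ∷ is) allA allB = allA (here refl) ∷ allB (here refl) ∷ all-pairs is (allA ∘ there) (allB ∘ there)

  ∈-pairs₁ : ∀ (A B : ℕ → X) {i n} → i < n → A i ∈ pairs A B (upTo n)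
  ∈-pairs₁ A B i<n = ∈-concatMap⁺ (λ i → A i ∷ B i ∷ []) (lose (∈-upTo⁺ i<n) (here refl))

  ∈-pairs₂ : ∀ (A B : ℕ → X) {i n} → i < n → B i ∈ pairs A B (upTo n)
  ∈-pairs₂ A B i<n = ∈-concatMap⁺ (λ i → A i ∷ B i ∷ []) (lose (∈-upTo⁺ i<n) (there (here refl)))

  -- `upTo` is `applyUpTo id`, whose tail is `applyUpTo suc`; a general `f` keeps the induction
  -- closed under this shift.
  linked-pairs : ∀ {ρ} {R : X → X → Set ρ} {A B : ℕ → X} (f : ℕ → ℕ) n {y ys} →
    (∀ {i} → i ≤ n → R (A (f i)) (B (f i))) → (∀ {i} → i < n → R (B (f i)) (A (f (suc i)))) →
    R (B (f n)) y → Linked R (y ∷ ys) → Linked R (pairs A B (applyUpTo f (suc n)) ++ y ∷ ys)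
  linked-pairs f zero    AB BA By linked = AB z≤n ∷ By ∷ linked
  linked-pairs f (suc n) AB BA By linked =
    AB z≤n ∷ BA (s≤s z≤n) ∷ linked-pairs (f ∘ suc) n (AB ∘ s≤s) (BA ∘ s≤s) By linked

-- Points and the maps that a, b and bᵏ induce on them

module Coordinates (h₁ : ℕ) where
  open ≡ using (refl; sym; trans; cong; cong₂; subst)

  h k : ℕ
  h = suc (suc h₁)
  k = 2 ℕ.* h

  -- (Q , u , p) stands for the element with index kQ + 2u + p, where u < h.
  Point : Set
  Point = Fin 4 × ℕ × Fin 2

  value : Point → ℕ
  value (Q , u , p) = k ℕ.* toℕ Q ℕ.+ (2 ℕ.* u ℕ.+ toℕ p)

  Valid : Point → Set
  Valid (_ , u , _) = u ≤ suc h₁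

  -- The map induced by b. The clauses down to the one for `(1F , suc u , 0F)` trace D₁, along which
  -- u climbs; the rest trace D₂, along which u descends. The test against `suc h₁`, that is h - 1,
  -- detects the end of a climbing run. Outside `Valid` the values are irrelevant.
  σ : Point → Point
  σ (0F , u     , 0F) = 2F , u , 1F
  σ (2F , u     , 1F) with u ℕ.<? suc h₁
  ... | yes _ = 0F , suc u , 0F
  ... | no  _ = 1F , 0 , 1F
  σ (1F , 0     , 1F) = 3F , 0 , 0F
  σ (3F , u     , 0F) with u ℕ.<? suc h₁
  ... | yes _ = 1F , suc u , 0F
  ... | no  _ = 0F , 0 , 0F
  σ (1F , suc u , 0F) = 3F , suc u , 0F
  σ (2F , suc u , 0F) = 1F , suc u , 1F
  σ (1F , suc u , 1F) = 2F , u , 0F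
  σ (2F , 0     , 0F) = 1F , 0 , 0F
  σ (1F , 0     , 0F) = 3F , suc h₁ , 1F
  σ (3F , u     , 1F) = 0F , u , 1F
  σ (0F , suc u , 1F) = 3F , u , 1F
  σ (0F , 0     , 1F) = 2F , suc h₁ , 0F

  -- The map induced by bᵏ.
  ζ : Point → Point
  ζ (0F , 0     , 0F) = 1F , 0 , 1F
  ζ (0F , suc u , 0F) = 1F , suc u , 0F
  ζ (0F , 0     , 1F) = 1F , 0 , 0F
  ζ (0F , suc u , 1F) = 1F , suc u , 1F
  ζ (1F , 0     , 0F) = 0F , 0 , 1F
  ζ (1F , suc u , 0F) = 0F , suc u , 0F
  ζ (1F , 0     , 1F) = 0F , 0 , 0F
  ζ (1F , suc u , 1F) = 0F , suc u , 1F
  ζ (2F , u     , 0F) = 3F , u , 1F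
  ζ (2F , u     , 1F) = 3F , u , 0F
  ζ (3F , u     , 0F) = 2F , u , 1F
  ζ (3F , u     , 1F) = 2F , u , 0F

  -- The map induced by a: as k is even, the two entries of a transposition differ only in the last
  -- coordinate.
  τ : Point → Point
  τ (Q , u , 0F) = Q , u , 1F
  τ (Q , u , 1F) = Q , u , 0F

  σ-valid : ∀ t → Valid t → Valid (σ t)
  σ-valid (0F , u     , 0F) v = v
  σ-valid (2F , u     , 1F) v with u ℕ.<? suc h₁
  ... | yes u< = u<
  ... | no  _  = z≤n
  σ-valid (1F , 0     , 1F) v = v
  σ-valid (3F , u     , 0F) v with u ℕ.<? suc h₁
  ... | yes u< = u<
  ... | no  _  = z≤n
  σ-valid (1F , suc u , 0F) v = v
  σ-valid (2F , suc u , 0F) v = v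
  σ-valid (1F , suc u , 1F) v = ℕ.<⇒≤ v
  σ-valid (2F , 0     , 0F) v = v
  σ-valid (1F , 0     , 0F) v = ℕ.≤-refl
  σ-valid (3F , u     , 1F) v = v
  σ-valid (0F , suc u , 1F) v = ℕ.<⇒≤ v
  σ-valid (0F , 0     , 1F) v = ℕ.≤-refl

  τ-valid : ∀ t → Valid t → Valid (τ t)
  τ-valid (_ , _ , 0F) v = v
  τ-valid (_ , _ , 1F) v = v

  σ-21 : ∀ {u} → u < suc h₁ → σ (2F , u , 1F) ≡ (0F , suc u , 0F)
  σ-21 {u} u< with u ℕ.<? suc h₁
  ... | yes _  = refl
  ... | no  u≮ = contradiction u< u≮

  σ-21-last : σ (2F , suc h₁ , 1F) ≡ (1F , 0 , 1F)
  σ-21-last with suc h₁ ℕ.<? suc h₁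
  ... | yes h<h = contradiction h<h (ℕ.<-irrefl refl)
  ... | no  _   = refl

  σ-30 : ∀ {u} → u < suc h₁ → σ (3F , u , 0F) ≡ (1F , suc u , 0F)
  σ-30 {u} u< with u ℕ.<? suc h₁
  ... | yes _  = refl
  ... | no  u≮ = contradiction u< u≮

  σ-30-last : σ (3F , suc h₁ , 0F) ≡ (0F , 0 , 0F)
  σ-30-last with suc h₁ ℕ.<? suc h₁
  ... | yes h<h = contradiction h<h (ℕ.<-irrefl refl)
  ... | no  _   = refl

  private
    last : ∀ {u} → u ≤ suc h₁ → ¬ u < suc h₁ → u ≡ suc h₁
    last u≤ u≮ = ℕ.≤-antisym u≤ (ℕ.≮⇒≥ u≮)

  σ∘ζ : ∀ t → σ (ζ t) ≡ ζ (σ t)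
  σ∘ζ (0F , 0     , 0F) = refl
  σ∘ζ (0F , suc u , 0F) = refl
  σ∘ζ (0F , 0     , 1F) = refl
  σ∘ζ (0F , suc u , 1F) = refl
  σ∘ζ (1F , 0     , 0F) = refl
  σ∘ζ (1F , suc u , 0F) = refl
  σ∘ζ (1F , 0     , 1F) = refl
  σ∘ζ (1F , suc u , 1F) = refl
  σ∘ζ (2F , 0     , 0F) = refl
  σ∘ζ (2F , suc u , 0F) = refl
  σ∘ζ (2F , u     , 1F) with u ℕ.<? suc h₁
  ... | yes _ = refl
  ... | no  _ = refl
  σ∘ζ (3F , u     , 0F) with u ℕ.<? suc h₁
  ... | yes _ = refl
  ... | no  _ = refl
  σ∘ζ (3F , 0     , 1F) = refl
  σ∘ζ (3F , suc u , 1F) = refl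

  ζ∘ζ : ∀ t → ζ (ζ t) ≡ t
  ζ∘ζ (0F , 0     , 0F) = refl
  ζ∘ζ (0F , suc u , 0F) = refl
  ζ∘ζ (0F , 0     , 1F) = refl
  ζ∘ζ (0F , suc u , 1F) = refl
  ζ∘ζ (1F , 0     , 0F) = refl
  ζ∘ζ (1F , suc u , 0F) = refl
  ζ∘ζ (1F , 0     , 1F) = refl
  ζ∘ζ (1F , suc u , 1F) = refl
  ζ∘ζ (2F , u     , 0F) = refl
  ζ∘ζ (2F , u     , 1F) = refl
  ζ∘ζ (3F , u     , 0F) = refl
  ζ∘ζ (3F , u     , 1F) = refl

  τ∘τ : ∀ t → τ (τ t) ≡ t
  τ∘τ (_ , _ , 0F) = refl
  τ∘τ (_ , _ , 1F) = refl

  -- This is bab = bᵏa on points. Validity is needed at the turning points: a failed test u < h - 1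
  -- then means u = h - 1.
  σ∘τ∘σ : ∀ t → Valid t → σ (τ (σ t)) ≡ ζ (τ t)
  σ∘τ∘σ (0F , 0     , 0F) v = refl
  σ∘τ∘σ (0F , suc u , 0F) v = refl
  σ∘τ∘σ (0F , 0     , 1F) v = σ-21-last
  σ∘τ∘σ (0F , suc u , 1F) v = σ-30 v
  σ∘τ∘σ (1F , 0     , 0F) v = σ-30-last
  σ∘τ∘σ (1F , suc u , 0F) v = refl
  σ∘τ∘σ (1F , 0     , 1F) v = refl
  σ∘τ∘σ (1F , suc u , 1F) v = σ-21 v
  σ∘τ∘σ (2F , 0     , 0F) v = refl
  σ∘τ∘σ (2F , suc u , 0F) v = refl
  σ∘τ∘σ (2F , u     , 1F) v with u ℕ.<? suc h₁
  ... | yes _  = refl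
  ... | no  u≮ rewrite last v u≮ = refl
  σ∘τ∘σ (3F , u     , 0F) v with u ℕ.<? suc h₁
  ... | yes _  = refl
  ... | no  u≮ rewrite last v u≮ = refl
  σ∘τ∘σ (3F , u     , 1F) v = refl

  -- The valid points form two orbits of `σ`, the cycles D₁ and D₂. Each base case starts one of
  -- them, and the proof walks once around each.
  σ-induction : ∀ {p} (P : Point → Set p) → P (0F , 0 , 0F) → P (0F , 0 , 1F) →
    (∀ t → Valid t → P t → P (σ t)) → ∀ t → Valid t → P t
  σ-induction P base₁ base₂ step = all
    where
    next : ∀ {t t′} → Valid t → σ t ≡ t′ → P t → P t′
    next v eq Pt = subst P eq (step _ v Pt)

    P00 : ∀ u → u ≤ suc h₁ → P (0F , u , 0F)
    P00 zero    v = base₁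
    P00 (suc u) v = next (ℕ.<⇒≤ v) (σ-21 v) (next (ℕ.<⇒≤ v) refl (P00 u (ℕ.<⇒≤ v)))

    P21 : ∀ u → u ≤ suc h₁ → P (2F , u , 1F)
    P21 u v = next v refl (P00 u v)

    P11-first : P (1F , 0 , 1F)
    P11-first = next ℕ.≤-refl σ-21-last (P21 (suc h₁) ℕ.≤-refl)

    P30 : ∀ u → u ≤ suc h₁ → P (3F , u , 0F)
    P30 zero    v = next z≤n refl P11-first
    P30 (suc u) v = next v refl (next (ℕ.<⇒≤ v) (σ-30 v) (P30 u (ℕ.<⇒≤ v)))

    -- D₂ visits u in descending order, so the recursion is on the distance v of u from the top
    -- value h - 1. The same holds for `P31`.
    P20 : ∀ v u → u ℕ.+ v ≡ suc h₁ → P (2F , u , 0F)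
    P20 zero    u eq = next {0F , 0 , 1F} z≤n (cong (λ n → 2F , n , 0F) (sym (trans (sym (ℕ.+-identityʳ u)) eq))) base₂
    P20 (suc v) u eq = next 1+u≤ refl (next 1+u≤ refl (P20 v (suc u) eq′))
      where
      eq′ : suc u ℕ.+ v ≡ suc h₁
      eq′ = trans (sym (ℕ.+-suc u v)) eq
      1+u≤ : suc u ≤ suc h₁
      1+u≤ = subst (suc u ≤_) eq′ (ℕ.m≤m+n (suc u) v)

    P20′ : ∀ u → u ≤ suc h₁ → P (2F , u , 0F)
    P20′ u v = P20 (suc h₁ ℕ.∸ u) u (ℕ.m+[n∸m]≡n v)

    P10-first : P (1F , 0 , 0F)
    P10-first = next z≤n refl (P20′ 0 z≤n)

    P31 : ∀ v u → u ℕ.+ v ≡ suc h₁ → P (3F , u , 1F)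
    P31 zero    u eq = next {1F , 0 , 0F} z≤n (cong (λ n → 3F , n , 1F) (sym (trans (sym (ℕ.+-identityʳ u)) eq))) P10-first
    P31 (suc v) u eq = next 1+u≤ refl (next 1+u≤ refl (P31 v (suc u) eq′))
      where
      eq′ : suc u ℕ.+ v ≡ suc h₁
      eq′ = trans (sym (ℕ.+-suc u v)) eq
      1+u≤ : suc u ≤ suc h₁
      1+u≤ = subst (suc u ≤_) eq′ (ℕ.m≤m+n (suc u) v)

    P31′ : ∀ u → u ≤ suc h₁ → P (3F , u , 1F)
    P31′ u v = P31 (suc h₁ ℕ.∸ u) u (ℕ.m+[n∸m]≡n v)

    all : ∀ t → Valid t → P t
    all (0F , u     , 0F) v = P00 u v
    all (0F , u     , 1F) v = next v refl (P31′ u v)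
    all (1F , zero  , 0F) v = P10-first
    all (1F , suc u , 0F) v = next (ℕ.<⇒≤ v) (σ-30 v) (P30 u (ℕ.<⇒≤ v))
    all (1F , zero  , 1F) v = P11-first
    all (1F , suc u , 1F) v = next v refl (P20′ (suc u) v)
    all (2F , u     , 0F) v = P20′ u v
    all (2F , u     , 1F) v = P21 u v
    all (3F , u     , 0F) v = P30 u v
    all (3F , u     , 1F) v = P31′ u v

  open Endo Point using (_^_)

  σ^-valid : ∀ n t → Valid t → Valid ((σ ^ n) t)
  σ^-valid zero    t v = v
  σ^-valid (suc n) t v = σ-valid ((σ ^ n) t) (σ^-valid n t v)

  σ-^-suc : ∀ n t → (σ ^ suc n) t ≡ (σ ^ n) (σ t)
  σ-^-suc zero    t = refl
  σ-^-suc (suc n) t = cong σ (σ-^-suc n t)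

  -- Both sides commute with `σ`, so it is enough to iterate k times from one point of each cycle.
  σ^k≡ζ : ∀ t → Valid t → (σ ^ k) t ≡ ζ t
  σ^k≡ζ = σ-induction (λ t → (σ ^ k) t ≡ ζ t)
    -- Here k = 2 + 2(h - 1). On D₁ the climb takes 2(h - 1) steps and two more reach
    -- `(1F , 0 , 1F)`; on D₂ one step enters the descent, which takes 2(h - 1), and one more leads
    -- to `(1F , 0 , 0F)`.
    (trans (cong (λ n → (σ ^ n) (0F , 0 , 0F)) k≡) (trans (cong (σ ∘ σ) (up (suc h₁) ℕ.≤-refl)) σ-21-last))
    (trans (cong (λ n → (σ ^ n) (0F , 0 , 1F)) k≡) (cong σ (down (suc h₁) 0 (ℕ.+-identityʳ (suc h₁)))))
    (λ t v eq → trans (sym (σ-^-suc k t)) (trans (cong σ eq) (σ∘ζ t)))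
    where
    k≡ : k ≡ 2 ℕ.+ 2 ℕ.* suc h₁
    k≡ = ℕ.*-suc 2 (suc h₁)

    up : ∀ u → u ≤ suc h₁ → (σ ^ (2 ℕ.* u)) (0F , 0 , 0F) ≡ (0F , u , 0F)
    up zero    v = refl
    up (suc u) v = trans (cong (λ n → (σ ^ n) (0F , 0 , 0F)) (ℕ.*-suc 2 u))
      (trans (cong (σ ∘ σ) (up u (ℕ.<⇒≤ v))) (σ-21 v))

    down : ∀ v u → v ℕ.+ u ≡ suc h₁ → (σ ^ suc (2 ℕ.* v)) (0F , 0 , 1F) ≡ (2F , u , 0F)
    down zero    u eq = cong (λ n → 2F , n , 0F) (sym eq)
    down (suc v) u eq = trans (cong (λ n → (σ ^ suc n) (0F , 0 , 1F)) (ℕ.*-suc 2 v))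
      (cong (σ ∘ σ) (down v (suc u) (trans (ℕ.+-suc v u) eq)))

  remainder<k : ∀ {u} p → u ≤ suc h₁ → 2 ℕ.* u ℕ.+ toℕ {2} p < k
  remainder<k {u} p u≤ = begin-strict
    2 ℕ.* u ℕ.+ toℕ p  <⟨ ℕ.+-monoʳ-< (2 ℕ.* u) (toℕ<n p) ⟩
    2 ℕ.* u ℕ.+ 2      ≡⟨ ℕ.+-comm (2 ℕ.* u) 2 ⟩
    2 ℕ.+ 2 ℕ.* u      ≡⟨ ℕ.*-suc 2 u ⟨
    2 ℕ.* suc u        ≤⟨ ℕ.*-monoʳ-≤ 2 (s≤s u≤) ⟩
    k                  ∎
    where open ℕ.≤-Reasoning

  code : ∀ t → Valid t → Fin (4 ℕ.* k)
  code (Q , u , p) v = combine Q (fromℕ< (remainder<k p v))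

  toℕ-code : ∀ t v → toℕ (code t v) ≡ value t
  toℕ-code (Q , u , p) v = trans (toℕ-combine Q (fromℕ< (remainder<k p v)))
    (cong (k ℕ.* toℕ Q ℕ.+_) (toℕ-fromℕ< (remainder<k p v)))

  value<4k : ∀ t → Valid t → value t < 4 ℕ.* k
  value<4k t v = subst (_< 4 ℕ.* k) (toℕ-code t v) (toℕ<n (code t v))

  binary-unique : ∀ {u u′} (p p′ : Fin 2) → 2 ℕ.* u ℕ.+ toℕ p ≡ 2 ℕ.* u′ ℕ.+ toℕ p′ → u ≡ u′ × p ≡ p′
  binary-unique {u} {u′} 0F 0F eq = ℕ.*-cancelˡ-≡ u u′ 2 (ℕ.+-cancelʳ-≡ 0 _ _ eq) , refl
  binary-unique {u} {u′} 1F 1F eq = ℕ.*-cancelˡ-≡ u u′ 2 (ℕ.+-cancelʳ-≡ 1 _ _ eq) , refl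
  binary-unique {u} {u′} 0F 1F eq =
    contradiction (trans (sym (ℕ.+-identityʳ _)) (trans eq (ℕ.+-comm _ 1))) (ℕ.even≢odd u u′)
  binary-unique {u} {u′} 1F 0F eq =
    contradiction (trans (sym (ℕ.+-identityʳ _)) (trans (sym eq) (ℕ.+-comm _ 1))) (ℕ.even≢odd u′ u)

  value-injective : ∀ t t′ → Valid t → Valid t′ → value t ≡ value t′ → t ≡ t′
  value-injective t@(Q , u , p) t′@(Q′ , u′ , p′) v v′ eq
    with refl , rem≡ ← combine-injective Q _ Q′ _ (toℕ-injective {i = code t v} {j = code t′ v′}
                         (trans (toℕ-code t v) (trans eq (sym (toℕ-code t′ v′)))))
    with refl , refl ← binary-unique {u} {u′} p p′ (fromℕ<-injective _ _ (remainder<k p v) (remainder<k p′ v′) rem≡) = refl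

  value-surjective : ∀ (i : Fin (4 ℕ.* k)) → ∃ λ t → Valid t × value t ≡ toℕ i
  value-surjective i = (Q , u , p) , ℕ.s≤s⁻¹ u<h , (begin
    k ℕ.* toℕ Q ℕ.+ (2 ℕ.* u ℕ.+ toℕ p)  ≡⟨ cong (k ℕ.* toℕ Q ℕ.+_) (begin
      2 ℕ.* u ℕ.+ toℕ p                    ≡⟨ ℕ.+-comm (2 ℕ.* u) (toℕ p) ⟩
      toℕ p ℕ.+ 2 ℕ.* u                    ≡⟨ cong₂ ℕ._+_ (toℕ-fromℕ< _) (ℕ.*-comm 2 u) ⟩
      toℕ s % 2 ℕ.+ u ℕ.* 2                ≡⟨ m≡m%n+[m/n]*n (toℕ s) 2 ⟨
      toℕ s                                ∎) ⟩
    k ℕ.* toℕ Q ℕ.+ toℕ s                ≡⟨ toℕ-combine Q s ⟨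
    toℕ (combine Q s)                    ≡⟨ cong toℕ (combine-remQuot {4} k i) ⟩
    toℕ i                                ∎)
    where
    open ≡.≡-Reasoning
    Q : Fin 4
    Q = proj₁ (remQuot k i)
    s : Fin k
    s = proj₂ (remQuot {4} k i)
    u : ℕ
    u = toℕ s / 2
    p : Fin 2
    p = toℕ s mod 2
    u<h : u < h
    u<h = m<n*o⇒m/o<n (subst (toℕ s <_) (ℕ.*-comm 2 h) (toℕ<n s))

  -- The entry lists of D₁ and D₂ as lists of points

  rise fall : Fin 4 → Fin 2 → ℕ → Point
  rise Q p i = Q , i , p
  fall Q p i = Q , suc h₁ ℕ.∸ i , p

  D₁-front D₁-back D₂-front D₂-back D₁ D₂ : List Point
  D₁-front = pairs (rise 0F 0F) (rise 2F 1F) (upTo h)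
  D₁-back  = pairs (rise 1F 0F ∘ suc) (rise 3F 0F ∘ suc) (upTo (suc h₁))
  D₂-front = pairs (fall 2F 0F) (fall 1F 1F) (upTo (suc h₁))
  D₂-back  = pairs (fall 3F 1F) (fall 0F 1F) (upTo h)
  D₁ = D₁-front ++ (1F , 0 , 1F) ∷ (3F , 0 , 0F) ∷ D₁-back
  D₂ = D₂-front ++ (2F , 0 , 0F) ∷ (1F , 0 , 0F) ∷ D₂-back

  private
    [k∸2]/2 : (k ℕ.∸ 2) / 2 ≡ suc h₁
    [k∸2]/2 = trans (cong (λ n → (n ℕ.∸ 2) / 2) (ℕ.*-comm 2 h)) (m*n/n≡m (suc h₁) 2)

    [k∸4]/2 : (k ℕ.∸ 4) / 2 ≡ h₁
    [k∸4]/2 = trans (cong (λ n → (n ℕ.∸ 4) / 2) (ℕ.*-comm 2 h)) (m*n/n≡m h₁ 2)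

    ∸-∸-≡ : ∀ {m x} y z → m ≡ x ℕ.+ y ℕ.+ z → m ℕ.∸ z ℕ.∸ y ≡ x
    ∸-∸-≡ {x = x} y z refl = trans (cong (ℕ._∸ y) (ℕ.m+n∸n≡m (x ℕ.+ y) z)) (ℕ.m+n∸n≡m x y)

    module Descending (j : ℕ) (j≤ : j ≤ suc h₁) where
      d : ℕ
      d = suc h₁ ℕ.∸ j

      k≡ : k ≡ 2 ℕ.* suc (j ℕ.+ d)
      k≡ = cong (λ n → 2 ℕ.* suc n) (sym (ℕ.m+[n∸m]≡n j≤))

      -- With d = h - 1 - j one has k = 2(1 + j + d). Substituting this removes the truncated
      -- subtractions and leaves a polynomial identity in j and d. The entry ck - e′ - 2j lies in
      -- block c′ and has parity bit e.
      at : ∀ c c′ e e′ →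
        (∀ j d → c ℕ.* (2 ℕ.* suc (j ℕ.+ d)) ≡
                 2 ℕ.* suc (j ℕ.+ d) ℕ.* c′ ℕ.+ (2 ℕ.* d ℕ.+ e) ℕ.+ 2 ℕ.* j ℕ.+ e′) →
        c ℕ.* k ℕ.∸ e′ ℕ.∸ 2 ℕ.* j ≡ k ℕ.* c′ ℕ.+ (2 ℕ.* d ℕ.+ e)
      at c c′ e e′ identity = ∸-∸-≡ (2 ℕ.* j) e′
        (subst (λ k → c ℕ.* k ≡ k ℕ.* c′ ℕ.+ (2 ℕ.* d ℕ.+ e) ℕ.+ 2 ℕ.* j ℕ.+ e′) (sym k≡) (identity j d))

      at-20 : 3 ℕ.* k ℕ.∸ 2 ℕ.∸ 2 ℕ.* j ≡ value (2F , d , 0F)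
      at-20 = at 3 2 0 2 solve-∀

      at-11 : 2 ℕ.* k ℕ.∸ 1 ℕ.∸ 2 ℕ.* j ≡ value (1F , d , 1F)
      at-11 = at 2 1 1 1 solve-∀

      at-31 : 4 ℕ.* k ℕ.∸ 1 ℕ.∸ 2 ℕ.* j ≡ value (3F , d , 1F)
      at-31 = at 4 3 1 1 solve-∀

      at-01 : k ℕ.∸ 1 ℕ.∸ 2 ℕ.* j ≡ value (0F , d , 1F)
      at-01 = trans (cong (λ n → n ℕ.∸ 1 ℕ.∸ 2 ℕ.* j) (sym (ℕ.*-identityˡ k))) (at 1 0 1 1 solve-∀)

    at-10 : ∀ k j → k ℕ.+ 2 ℕ.* j ℕ.+ 2 ≡ k ℕ.* 1 ℕ.+ (2 ℕ.* suc j ℕ.+ 0)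
    at-10 = solve-∀

    at-30 : ∀ k j → 3 ℕ.* k ℕ.+ 2 ℕ.* j ℕ.+ 2 ≡ k ℕ.* 3 ℕ.+ (2 ℕ.* suc j ℕ.+ 0)
    at-30 = solve-∀

    at-21 : ∀ k i → 2 ℕ.* i ℕ.+ 2 ℕ.* k ℕ.+ 1 ≡ k ℕ.* 2 ℕ.+ (2 ℕ.* i ℕ.+ 1)
    at-21 = solve-∀

    at-00 : ∀ k i → 2 ℕ.* i ≡ k ℕ.* 0 ℕ.+ (2 ℕ.* i ℕ.+ 0)
    at-00 = solve-∀

    at-first : ∀ k c → c ℕ.* k ≡ k ℕ.* c ℕ.+ 0
    at-first = solve-∀

    at-10-first : ∀ k → k ≡ k ℕ.* 1 ℕ.+ 0
    at-10-first = solve-∀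

    at-11-first : ∀ k → k ℕ.+ 1 ≡ k ℕ.* 1 ℕ.+ 1
    at-11-first = solve-∀

  module _ {c r : Level} (F : FiniteField c r (4 ℕ.* k)) where
    D₁-indices≡ : D₁-indices F k ≡ map value D₁
    D₁-indices≡ rewrite [k∸2]/2 | [k∸4]/2 = trans
      (cong₂ _++_
        (map-pairs value (rise 0F 0F) (rise 2F 1F) (upTo h) (λ {i} _ → at-00 k i) (λ {i} _ → at-21 k i))
        (cong₂ _∷_ (at-11-first k) (cong₂ _∷_ (at-first k 3)
          (map-pairs value (rise 1F 0F ∘ suc) (rise 3F 0F ∘ suc) (upTo (suc h₁))
            (λ {j} _ → at-10 k j) (λ {j} _ → at-30 k j)))))
      (sym (map-++ value D₁-front ((1F , 0 , 1F) ∷ (3F , 0 , 0F) ∷ D₁-back)))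

    D₂-indices≡ : D₂-indices F k ≡ map value D₂
    D₂-indices≡ rewrite [k∸2]/2 | [k∸4]/2 = trans
      (cong₂ _++_
        (map-pairs value (fall 2F 0F) (fall 1F 1F) (upTo (suc h₁))
          (λ {j} j∈ → Descending.at-20 j (ℕ.<⇒≤ (∈-upTo⁻ j∈)))
          (λ {j} j∈ → Descending.at-11 j (ℕ.<⇒≤ (∈-upTo⁻ j∈))))
        (cong₂ _∷_ (at-first k 2) (cong₂ _∷_ (at-10-first k)
          (map-pairs value (fall 3F 1F) (fall 0F 1F) (upTo h)
            (λ {j} j∈ → Descending.at-31 j (ℕ.s≤s⁻¹ (∈-upTo⁻ j∈)))
            (λ {j} j∈ → Descending.at-01 j (ℕ.s≤s⁻¹ (∈-upTo⁻ j∈)))))))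
      (sym (map-++ value D₂-front ((2F , 0 , 0F) ∷ (1F , 0 , 0F) ∷ D₂-back)))

  Successive : Point → Point → Set
  Successive s t = σ s ≡ t

  D₁-linked : Linked Successive (D₁ ++ [ 0F , 0 , 0F ])
  D₁-linked = subst (Linked Successive) (sym (++-assoc D₁-front _ _))
    (linked-pairs id (suc h₁) (λ _ → refl) σ-21 σ-21-last
      (refl ∷ refl ∷ linked-pairs id h₁ (λ _ → refl) (λ i< → σ-30 (s≤s i<)) σ-30-last [-]))

  private
    -- `σ` distinguishes u = 0 from a successor; this exposes the successor as long as a descending
    -- run has not ended.
    ∸-pred : ∀ {i n} → i < n → n ℕ.∸ i ≡ suc (n ℕ.∸ suc i)
    ∸-pred {n = suc n} (s≤s i≤n) = ℕ.+-∸-assoc 1 i≤n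

  σ-fall-20 : ∀ {i} → i < suc h₁ → σ (fall 2F 0F i) ≡ fall 1F 1F i
  σ-fall-20 i< rewrite ∸-pred i< = refl

  σ-fall-11 : ∀ {i} → i < suc h₁ → σ (fall 1F 1F i) ≡ fall 2F 0F (suc i)
  σ-fall-11 i< rewrite ∸-pred i< = refl

  σ-fall-01 : ∀ {i} → i < suc h₁ → σ (fall 0F 1F i) ≡ fall 3F 1F (suc i)
  σ-fall-01 i< rewrite ∸-pred i< = refl

  D₂-linked : Linked Successive (D₂ ++ [ 2F , suc h₁ , 0F ])
  D₂-linked = subst (Linked Successive) (sym (++-assoc D₂-front _ _))
    (linked-pairs id h₁ (σ-fall-20 ∘ s≤s) (λ i< → σ-fall-11 (ℕ.<⇒≤ (s≤s i<)))
      (trans (σ-fall-11 ℕ.≤-refl) (cong (rise 2F 0F) (ℕ.n∸n≡0 h₁)))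
      (refl ∷ refl ∷ linked-pairs id (suc h₁) (λ _ → refl) σ-fall-01
        (cong (σ ∘ rise 0F 1F) (ℕ.n∸n≡0 h₁)) [-]))

  -- The indicator of the support of D₁; on valid points its complement is the support of D₂.
  on-D₁ : Point → Bool
  on-D₁ (0F , _     , 0F) = true
  on-D₁ (0F , _     , 1F) = false
  on-D₁ (1F , zero  , 0F) = false
  on-D₁ (1F , suc _ , 0F) = true
  on-D₁ (1F , zero  , 1F) = true
  on-D₁ (1F , suc _ , 1F) = false
  on-D₁ (2F , _     , 0F) = false
  on-D₁ (2F , _     , 1F) = true
  on-D₁ (3F , _     , 0F) = true
  on-D₁ (3F , _     , 1F) = false

  -- Needed for the product D₁D₂: a point moved by D₂ must land where D₁ leaves it alone.
  on-D₁-σ : ∀ t → on-D₁ (σ t) ≡ on-D₁ t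
  on-D₁-σ (0F , u     , 0F) = refl
  on-D₁-σ (0F , zero  , 1F) = refl
  on-D₁-σ (0F , suc u , 1F) = refl
  on-D₁-σ (1F , zero  , 0F) = refl
  on-D₁-σ (1F , suc u , 0F) = refl
  on-D₁-σ (1F , zero  , 1F) = refl
  on-D₁-σ (1F , suc u , 1F) = refl
  on-D₁-σ (2F , zero  , 0F) = refl
  on-D₁-σ (2F , suc u , 0F) = refl
  on-D₁-σ (2F , u     , 1F) with u ℕ.<? suc h₁
  ... | yes _ = refl
  ... | no  _ = refl
  on-D₁-σ (3F , u     , 0F) with u ℕ.<? suc h₁
  ... | yes _ = refl
  ... | no  _ = refl
  on-D₁-σ (3F , u     , 1F) = refl

  D₁-sound : All (λ t → Valid t × on-D₁ t ≡ true) D₁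
  D₁-sound = All.++⁺
    (all-pairs (upTo h) (λ u∈ → ℕ.s≤s⁻¹ (∈-upTo⁻ u∈) , refl) (λ u∈ → ℕ.s≤s⁻¹ (∈-upTo⁻ u∈) , refl))
    ((z≤n , refl) ∷ (z≤n , refl) ∷
      all-pairs (upTo (suc h₁)) (λ j∈ → ∈-upTo⁻ j∈ , refl) (λ j∈ → ∈-upTo⁻ j∈ , refl))

  D₂-sound : All (λ t → Valid t × on-D₁ t ≡ false) D₂
  D₂-sound = All.++⁺
    (all-pairs (upTo (suc h₁)) (λ {j} _ → ℕ.m∸n≤m (suc h₁) j , refl)
      (λ {j} j∈ → ℕ.m∸n≤m (suc h₁) j ,
        subst (λ n → on-D₁ (1F , n , 1F) ≡ false) (sym (∸-pred (∈-upTo⁻ j∈))) refl))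
    ((z≤n , refl) ∷ (z≤n , refl) ∷
      all-pairs (upTo h) (λ {j} _ → ℕ.m∸n≤m (suc h₁) j , refl) (λ {j} _ → ℕ.m∸n≤m (suc h₁) j , refl))

  ∈-D₁ : ∀ t → Valid t → on-D₁ t ≡ true → t ∈ D₁
  ∈-D₁ (0F , u     , 0F) v _ = ∈-++⁺ˡ (∈-pairs₁ (rise 0F 0F) (rise 2F 1F) (s≤s v))
  ∈-D₁ (1F , zero  , 1F) v _ = ∈-++⁺ʳ D₁-front (here refl)
  ∈-D₁ (1F , suc u , 0F) v _ =
    ∈-++⁺ʳ D₁-front (there (there (∈-pairs₁ (rise 1F 0F ∘ suc) (rise 3F 0F ∘ suc) v)))
  ∈-D₁ (2F , u     , 1F) v _ = ∈-++⁺ˡ (∈-pairs₂ (rise 0F 0F) (rise 2F 1F) (s≤s v))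
  ∈-D₁ (3F , zero  , 0F) v _ = ∈-++⁺ʳ D₁-front (there (here refl))
  ∈-D₁ (3F , suc u , 0F) v _ =
    ∈-++⁺ʳ D₁-front (there (there (∈-pairs₂ (rise 1F 0F ∘ suc) (rise 3F 0F ∘ suc) v)))
  ∈-D₁ (0F , _     , 1F) v ()
  ∈-D₁ (1F , zero  , 0F) v ()
  ∈-D₁ (1F , suc _ , 1F) v ()
  ∈-D₁ (2F , _     , 0F) v ()
  ∈-D₁ (3F , _     , 1F) v ()

  ∈-D₂ : ∀ t → Valid t → on-D₁ t ≡ false → t ∈ D₂
  -- In a descending run u stands at position h - 1 - u, and the double subtraction is undone by
  -- `ℕ.m∸[m∸n]≡n`.
  ∈-D₂ (0F , u     , 1F) v _ = ∈-++⁺ʳ D₂-front (there (there (subst (λ n → rise 0F 1F n ∈ D₂-back)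
    (ℕ.m∸[m∸n]≡n v) (∈-pairs₂ (fall 3F 1F) (fall 0F 1F) (s≤s (ℕ.m∸n≤m (suc h₁) u))))))
  ∈-D₂ (1F , zero  , 0F) v _ = ∈-++⁺ʳ D₂-front (there (here refl))
  ∈-D₂ (1F , suc u , 1F) v _ = ∈-++⁺ˡ (subst (λ n → rise 1F 1F n ∈ D₂-front)
    (ℕ.m∸[m∸n]≡n v) (∈-pairs₂ (fall 2F 0F) (fall 1F 1F) (s≤s (ℕ.m∸n≤m h₁ u))))
  ∈-D₂ (2F , zero  , 0F) v _ = ∈-++⁺ʳ D₂-front (here refl)
  ∈-D₂ (2F , suc u , 0F) v _ = ∈-++⁺ˡ (subst (λ n → rise 2F 0F n ∈ D₂-front)
    (ℕ.m∸[m∸n]≡n v) (∈-pairs₁ (fall 2F 0F) (fall 1F 1F) (s≤s (ℕ.m∸n≤m h₁ u))))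
  ∈-D₂ (3F , u     , 1F) v _ = ∈-++⁺ʳ D₂-front (there (there (subst (λ n → rise 3F 1F n ∈ D₂-back)
    (ℕ.m∸[m∸n]≡n v) (∈-pairs₁ (fall 3F 1F) (fall 0F 1F) (s≤s (ℕ.m∸n≤m (suc h₁) u))))))
  ∈-D₂ (0F , _     , 0F) v ()
  ∈-D₂ (1F , zero  , 1F) v ()
  ∈-D₂ (1F , suc _ , 0F) v ()
  ∈-D₂ (2F , _     , 1F) v ()
  ∈-D₂ (3F , _     , 0F) v ()

  -- The action of a and b on field elements

  module Action {c r : Level} (F : FiniteField c r (4 ℕ.* k)) where
    open FiniteField F using (Carrier; _≈_)
    open FieldTheory F using (index; element-index)

    enc : Point → Carrier
    enc t = elementℕ F (value t)

    enc-injective : ∀ {s t} → Valid s → Valid t → enc s ≈ enc t → s ≡ t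
    enc-injective {s} {t} vs vt eq =
      value-injective s t vs vt (elementℕ-injective F (value<4k s vs) (value<4k t vt) eq)

    enc-surjective : ∀ x → ∃ λ t → Valid t × enc t ≈ x
    enc-surjective x = let t , v , value≡ = value-surjective (index x) in
      t , v , FiniteField.trans F
        (FiniteField.reflexive F (trans (cong (elementℕ F) value≡) (elementℕ-toℕ F (index x)))) (element-index x)

    cycle₁ cycle₂ : Carrier → Carrier
    cycle₁ = cycle F (map (elementℕ F) (D₁-indices F k))
    cycle₂ = cycle F (map (elementℕ F) (D₂-indices F k))

    private
      cycle₁≡ : ∀ x → cycle₁ x ≡ cycle F (map enc D₁) x
      cycle₁≡ x = cong (λ es → cycle F es x) (trans (cong (map (elementℕ F)) (D₁-indices≡ F)) (sym (map-∘ D₁)))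

      cycle₂≡ : ∀ x → cycle₂ x ≡ cycle F (map enc D₂) x
      cycle₂≡ x = cong (λ es → cycle F es x) (trans (cong (map (elementℕ F)) (D₂-indices≡ F)) (sym (map-∘ D₂)))

      separated : ∀ {t} {b} {L} → Valid t → All (λ e → Valid e × on-D₁ e ≡ b) L → on-D₁ t ≢ b →
        All (λ x → ¬ enc t ≈ x) (map enc L)
      separated v sound t-off = All.map⁺ (All.map
        (λ { (ve , e-on) eq → t-off (trans (cong on-D₁ (enc-injective v ve eq)) e-on) }) sound)

    cycle₁-on : ∀ {t} → Valid t → on-D₁ t ≡ true → cycle₁ (enc t) ≡ enc (σ t)
    cycle₁-on {t} v on = trans (cycle₁≡ (enc t)) (cycle-follows F σ enc _ _ D₁-linked
      (λ e∈ → enc-injective v (proj₁ (All.lookup D₁-sound e∈))) (∈-D₁ t v on))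

    cycle₂-on : ∀ {t} → Valid t → on-D₁ t ≡ false → cycle₂ (enc t) ≡ enc (σ t)
    cycle₂-on {t} v on = trans (cycle₂≡ (enc t)) (cycle-follows F σ enc _ _ D₂-linked
      (λ e∈ → enc-injective v (proj₁ (All.lookup D₂-sound e∈))) (∈-D₂ t v on))

    cycle₁-off : ∀ {t} → Valid t → on-D₁ t ≡ false → cycle₁ (enc t) ≡ enc t
    cycle₁-off {t} v off = trans (cycle₁≡ (enc t)) (cycle-fixes F (map enc D₁)
      (separated v D₁-sound (λ on → contradiction (trans (sym off) on) λ ())))

    cycle₂-off : ∀ {t} → Valid t → on-D₁ t ≡ true → cycle₂ (enc t) ≡ enc t
    cycle₂-off {t} v off = trans (cycle₂≡ (enc t)) (cycle-fixes F (map enc D₂)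
      (separated v D₂-sound (λ on → contradiction (trans (sym off) on) λ ())))

    -- Exactly one of the two cycles moves a given point, along `σ`; the other one fixes both the
    -- point and its image.
    b-enc : ∀ t → Valid t → b F k (enc t) ≡ enc (σ t)
    b-enc t v = by-cycle (on-D₁ t) refl
      where
      by-cycle : ∀ on → on-D₁ t ≡ on → b F k (enc t) ≡ enc (σ t)
      by-cycle true  on  = trans (cong cycle₁ (cycle₂-off v on)) (cycle₁-on v on)
      by-cycle false off = trans (cong cycle₁ (cycle₂-on v off)) (cycle₁-off (σ-valid t v) (trans (on-D₁-σ t) off))

    private
      q-even : 4 ℕ.* k ≡ 4 ℕ.* k / 2 ℕ.* 2
      q-even = trans (4k≡2k*2 k)
        (cong (ℕ._* 2) (sym (trans (cong (_/ 2) (4k≡2k*2 k)) (m*n/n≡m (2 ℕ.* k) 2))))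

      -- The number of the transposition that contains the point: kQ + 2u is twice hQ + u.
      half : Point → ℕ
      half (Q , u , _) = h ℕ.* toℕ Q ℕ.+ u

      value-even : ∀ Q u → 2 ℕ.* half (Q , u , 0F) ≡ value (Q , u , 0F)
      value-even Q u = identity h (toℕ Q) u
        where
        identity : ∀ h Q u → 2 ℕ.* (h ℕ.* Q ℕ.+ u) ≡ 2 ℕ.* h ℕ.* Q ℕ.+ (2 ℕ.* u ℕ.+ 0)
        identity = solve-∀

      value-odd : ∀ Q u → 2 ℕ.* half (Q , u , 0F) ℕ.+ 1 ≡ value (Q , u , 1F)
      value-odd Q u = identity h (toℕ Q) u
        where
        identity : ∀ h Q u → 2 ℕ.* (h ℕ.* Q ℕ.+ u) ℕ.+ 1 ≡ 2 ℕ.* h ℕ.* Q ℕ.+ (2 ℕ.* u ℕ.+ 1)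
        identity = solve-∀

      half< : ∀ Q u → u ≤ suc h₁ → half (Q , u , 0F) < 4 ℕ.* k / 2
      half< Q u v = ℕ.*-cancelˡ-< 2 _ _ (subst (_< 2 ℕ.* (4 ℕ.* k / 2)) (sym (value-even Q u))
        (subst (value (Q , u , 0F) <_) (trans q-even (ℕ.*-comm (4 ℕ.* k / 2) 2)) (value<4k (Q , u , 0F) v)))

    a-enc : ∀ t → Valid t → a F (enc t) ≡ enc (τ t)
    a-enc (Q , u , 0F) v = a-swaps F q-even (half< Q u v)
      (≡.subst₂ (Matched F _) (value-even Q u) (value-odd Q u) even-odd)
    a-enc (Q , u , 1F) v = a-swaps F q-even (half< Q u v)
      (≡.subst₂ (Matched F _) (value-odd Q u) (value-even Q u) odd-even)

-- From the tuple to the companion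

open import Data.Nat.Base using (_*_; _^_)

module WordTuples {c r : Level} (h₁ : ℕ) (F : FiniteField c r (4 * Coordinates.k h₁)) where
  open Coordinates h₁
  open FiniteField F using (Carrier; _≈_; setoid; 0#; refl; sym; trans; reflexive)
  open FieldTheory F
  open Endo Carrier using () renaming (_^_ to _^∘_)
  open Endo Point using () renaming (_^_ to _^ₚ_)
  open Inverse using (to; from; to-cong; from-cong; strictlyInverseʳ)
  open SetoidReasoning setoid

  module _
    (s t : Carrier → Carrier) (enc : Point → Carrier)
    (enc-surjective : ∀ x → ∃ λ p → Valid p × enc p ≈ x)
    (s-enc : ∀ p → Valid p → s (enc p) ≡ enc (τ p))
    (t-enc : ∀ p → Valid p → t (enc p) ≡ enc (σ p))
    (f : Polynomial F) (f-lpp : IsLPP F f)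
    (β : Fin (4 * k) → Permutation F) (β-tuple : IsTupleOf F β f)
    (β-words : ∀ m → IsWord k s t (to (β m)))
    (words-β : ∀ g → IsWord k s t g → ∃ λ m → ∀ x → to (β m) x ≈ g x)
    where

    -- The generators are bare functions, not known beforehand to respect `≈`. Every word agrees
    -- with an entry of the tuple, and such an entry respects `≈` as a permutation of the setoid.
    word-cong : ∀ g → IsWord k s t g → ∀ {x y} → x ≈ y → g x ≈ g y
    word-cong g g-word {x} {y} x≈y = let m , βₘ≈g = words-β g g-word in
      trans (sym (βₘ≈g x)) (trans (to-cong (β m) x≈y) (βₘ≈g y))

    s-cong : ∀ {x y} → x ≈ y → s x ≈ s y
    s-cong = word-cong s (0 , 1 , z≤n , s≤s z≤n , λ _ → refl)

    t-cong : ∀ {x y} → x ≈ y → t x ≈ t y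
    t-cong = word-cong t (1 , 0 , s≤s z≤n , z≤n , λ _ → refl)

    t^-cong : ∀ n {x y} → x ≈ y → (t ^∘ n) x ≈ (t ^∘ n) y
    t^-cong zero    x≈y = x≈y
    t^-cong (suc n) x≈y = t-cong (t^-cong n x≈y)

    t^-enc : ∀ n p → Valid p → (t ^∘ n) (enc p) ≡ enc ((σ ^ₚ n) p)
    t^-enc zero    p v = ≡.refl
    t^-enc (suc n) p v = ≡.trans (≡.cong t (t^-enc n p v)) (t-enc ((σ ^ₚ n) p) (σ^-valid n p v))

    t^k-enc : ∀ p → Valid p → (t ^∘ k) (enc p) ≡ enc (ζ p)
    t^k-enc p v = ≡.trans (t^-enc k p v) (≡.cong enc (σ^k≡ζ p v))

    from-points : (φ ψ : Carrier → Carrier) → (∀ {x y} → x ≈ y → φ x ≈ φ y) → (∀ {x y} → x ≈ y → ψ x ≈ ψ y) →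
      (∀ p → Valid p → φ (enc p) ≡ ψ (enc p)) → ∀ x → φ x ≈ ψ x
    from-points φ ψ φ-cong ψ-cong agree x = let p , v , p≈x = enc-surjective x in
      trans (φ-cong (sym p≈x)) (trans (reflexive (agree p v)) (ψ-cong p≈x))

    s∘s : ∀ x → s (s x) ≈ x
    s∘s = from-points (s ∘ s) id (s-cong ∘ s-cong) id λ p v →
      ≡.trans (≡.cong s (s-enc p v)) (≡.trans (s-enc (τ p) (τ-valid p v)) (≡.cong enc (τ∘τ p)))

    t∘s∘t : ∀ x → t (s (t x)) ≈ (t ^∘ k) (s x)
    t∘s∘t = from-points (t ∘ s ∘ t) ((t ^∘ k) ∘ s) (t-cong ∘ s-cong ∘ t-cong) (t^-cong k ∘ s-cong) λ p v →
      let σv = σ-valid p v ; τv = τ-valid p v in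
      ≡.trans (≡.cong (t ∘ s) (t-enc p v))
        (≡.trans (≡.cong t (s-enc (σ p) σv))
        (≡.trans (t-enc (τ (σ p)) (τ-valid (σ p) σv))
        (≡.trans (≡.cong enc (σ∘τ∘σ p v))
        (≡.sym (≡.trans (≡.cong (t ^∘ k) (s-enc p v)) (t^k-enc (τ p) τv))))))

    t^2k : ∀ x → (t ^∘ (2 * k)) x ≈ x
    t^2k = from-points (t ^∘ (2 * k)) id (t^-cong (2 * k)) id λ p v →
      ≡.trans (≡.cong (λ n → (t ^∘ n) (enc p)) (≡.cong (k ℕ.+_) (ℕ.+-identityʳ k)))
        (≡.trans (≡.cong-app (Endo.^-homo Carrier t k k) (enc p))
        (≡.trans (≡.cong (t ^∘ k) (t^k-enc p v))
        (≡.trans (t^k-enc (ζ p) (ζ-valid p v)) (≡.cong enc (ζ∘ζ p)))))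
      where
      ζ-valid : ∀ p → Valid p → Valid (ζ p)
      ζ-valid p v = ≡.subst Valid (σ^k≡ζ p v) (σ^-valid k p v)

    tuple-separates : ∀ m m′ x → to (β m) x ≈ to (β m′) x → m ≡ m′
    tuple-separates m m′ x eq with m ≟ᶠ m′
    ... | yes m≡m′ = m≡m′
    ... | no  m≢m′ = contradiction
      (trans (from-cong (β m) (sym eq)) (strictlyInverseʳ (β m) x)) (proj₁ β-tuple m m′ m≢m′ x)

    exponents : Fin (4 * k) → Fin (2 * k * 2)
    exponents m = let j , i , j≤ , i≤ , _ = β-words m in combine (fromℕ< (s≤s j≤)) (fromℕ< (s≤s i≤))

    word : ℕ → ℕ → Carrier → Carrier
    word j i x = (t ^∘ j) ((s ^∘ i) x)

    exponents-sound : ∀ m {j i} (j<2k : j < 2 * k) (i<2 : i < 2) →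
      exponents m ≡ combine (fromℕ< j<2k) (fromℕ< i<2) → ∀ x → to (β m) x ≈ word j i x
    exponents-sound m {j} {i} j<2k i<2 eq x =
      let j′ , i′ , j′≤ , i′≤ , βₘ≈ = β-words m
          j≡ , i≡ = combine-injective (fromℕ< (s≤s j′≤)) (fromℕ< (s≤s i′≤)) (fromℕ< j<2k) (fromℕ< i<2) eq
      in trans (βₘ≈ x) (reflexive (≡.cong₂ (λ j i → word j i x)
           (fromℕ<-injective j′ j (s≤s j′≤) j<2k j≡) (fromℕ<-injective i′ i (s≤s i′≤) i<2 i≡)))

    exponents-injective : ∀ {m m′} → exponents m ≡ exponents m′ → m ≡ m′
    exponents-injective {m} {m′} eq = let _ , _ , j≤ , i≤ , βₘ′≈ = β-words m′ in
      -- Entries with equal exponents agree everywhere, and distinct entries agree nowhere; `0#` is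
      -- merely some point at which to compare them.
      tuple-separates m m′ 0# (trans (exponents-sound m (s≤s j≤) (s≤s i≤) eq 0#) (sym (βₘ′≈ 0#)))

    exponents-surjective : ∀ y → ∃ λ m → exponents m ≡ y
    exponents-surjective = injective⇒surjective (4k≡2k*2 k) exponents exponents-injective

    -- By counting, every exponent pair is the one chosen for some tuple entry. Two words that agree
    -- at x thus give two entries that agree at x; these have the same index, and so the same
    -- exponents.
    word-unique : ∀ {j i j′ i′} x → j < 2 * k → i < 2 → j′ < 2 * k → i′ < 2 →
      word j i x ≈ word j′ i′ x → j ≡ j′ × i ≡ i′
    word-unique {j} {i} {j′} {i′} x j< i< j′< i′< eq =
      let m  , m-exp  = exponents-surjective (combine (fromℕ< j<) (fromℕ< i<))
          m′ , m′-exp = exponents-surjective (combine (fromℕ< j′<) (fromℕ< i′<))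
          m≡m′ = tuple-separates m m′ x
            (trans (exponents-sound m j< i< m-exp x) (trans eq (sym (exponents-sound m′ j′< i′< m′-exp x))))
          j≡ , i≡ = combine-injective (fromℕ< j<) (fromℕ< i<) (fromℕ< j′<) (fromℕ< i′<)
            (≡.trans (≡.sym m-exp) (≡.trans (≡.cong exponents m≡m′) m′-exp))
      in fromℕ<-injective j j′ j< j′< j≡ , fromℕ<-injective i i′ i< i′< i≡

    t-exponent-unique : ∀ m n x → m < 2 * k → n < 2 * k → (t ^∘ m) x ≈ (t ^∘ n) x → m ≡ n
    t-exponent-unique m n x m< n< eq =
      proj₁ (word-unique {m} {0} {n} {0} x m< (s≤s z≤n) n< (s≤s z≤n) eq)

    t-cosets-disjoint : ∀ m n x → m < 2 * k → n < 2 * k → ¬ (t ^∘ m) x ≈ (t ^∘ n) (s x)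
    t-cosets-disjoint m n x m< n< eq = contradiction
      (proj₂ (word-unique {m} {0} {n} {1} x m< (s≤s z≤n) n< (s≤s (s≤s z≤n)) eq)) λ ()

    open Semidihedral.Relations (suc h₁) F s t s-cong t-cong s∘s t^2k t∘s∘t t-exponent-unique t-cosets-disjoint
      using (piece; offset; β-latin; γ-latin; δ-latin; β-word; β∘γ≈δ) renaming (β to B)

    position : ∀ i → ∃ λ m → ∀ x → to (β m) x ≈ B (piece i) (offset i) x
    position i = words-β _ (β-word (piece i) (offset i))

    has-companion : ∃ λ g → IsCompanion F f g
    has-companion = companion f f-lpp _ _ _ β-latin γ-latin δ-latin
      (λ i → β∘γ≈δ (piece i) (offset i))
      (proj₁ ∘ position)
      -- Two members of the family at the same place of the tuple agree everywhere, in particular at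
      -- `0#`, so the Latin property of `B` identifies them.
      (λ {i} {j} eq → LatinFamily.injective-index β-latin 0# (begin
        B (piece i) (offset i) 0#         ≈⟨ proj₂ (position i) 0# ⟨
        to (β (proj₁ (position i))) 0#    ≡⟨ ≡.cong (λ m → to (β m) 0#) eq ⟩
        to (β (proj₁ (position j))) 0#    ≈⟨ proj₂ (position j) 0# ⟩
        B (piece j) (offset j) 0#         ∎))
      (λ i x → trans (eval-cong f refl (sym (proj₂ (position i) x))) (proj₂ β-tuple (proj₁ (position i)) x))

theorem4p10 : ∀ {c r} (ℓ : ℕ) → 2 ≤ ℓ →
    let k = 2 ^ ℓ
        q = 4 * k in
    (F : FiniteField c r q) (f : Polynomial F) → IsLPP F f →
    (β : Fin q → Permutation F) → IsTupleOf F β f → ConsistsOfG₃ F k β →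
    ∃ λ (g : Polynomial F) → IsCompanion F f g
theorem4p10 (suc (suc n)) (s≤s (s≤s z≤n)) =
  -- With ℓ = n + 2 and h = 2ⁿ⁺¹, k is 2h by computation, and h ≥ 2 because 2ⁿ ≥ 1.
  with-half (2 ^ suc n) (ℕ.m≤n⇒∃[o]m+o≡n (ℕ.*-monoʳ-≤ 2 (ℕ.m^n>0 2 n)))
  where
  -- The type of the field depends on h, so h is made a variable before it is replaced by 2 + h₁.
  with-half : ∀ {c r} h → (∃ λ h₁ → 2 ℕ.+ h₁ ≡ h) →
    (F : FiniteField c r (4 * (2 * h))) (f : Polynomial F) → IsLPP F f →
    (β : Fin (4 * (2 * h)) → Permutation F) → IsTupleOf F β f → ConsistsOfG₃ F (2 * h) β →
    ∃ λ (g : Polynomial F) → IsCompanion F f g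
  with-half _ (h₁ , ≡.refl) F f f-lpp β β-tuple (β-words , words-β) =
    let module A = Coordinates.Action h₁ F in
    WordTuples.has-companion h₁ F (a F) (b F (2 * (2 ℕ.+ h₁))) A.enc A.enc-surjective A.a-enc A.b-enc f f-lpp β β-tuple β-words words-β
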